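{- Let $m,n$ be positive integers such that $m>n$, $\gcd(m,n)=1$ and $m\not\equiv n \pmod 2$. If $m^{2}+n^{2}\equiv 5 \pmod 8$, and $m+n$ and $m-n$ are prime numbers, then the only solution in positive integers $(x,y,z)$ of the equation \[ x^{2}+(m^{2}-n^{2})^{y}=(m^{2}+n^{2})^{z} \] is $(x,y,z)=(2mn,2,2)$. -}

module Defs where

module Submission where

-- Put p = m + n, q = m - n, b = p q and c = m² + n², so that 2c = p² + q² and c + b = 2m². As
-- b ≡ ±3 (mod 8), 2 is not a quadratic residue modulo b, whereas an odd z would make it one; hence
-- z = 2k. The coprime factors cᵏ ± x of bʸ leave 2cᵏ = bʸ + 1 or 2cᵏ = pʸ + qʸ.
-- In the first case y is even by reduction modulo 8, and k is odd (again 2 is no residue). Factoring bʸ + 1 in ℤ[i]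
-- then gives 2c = w² + 1 with w a divisor of a power of p q, and p² + q² = w² + 1 forces q² ∣ w, so
-- that w is too large.
-- In the second case y is even since p + q = 2m is coprime to c, and y/2 is odd since otherwise c ∣ 2.
-- If y/2 had a prime factor r, the cofactor (p²ʳ + q²ʳ) / 2c would divide a power of c, which forces
-- it to be at most r. So y = 2 and k = 1.

open import Defs
open import Relation.Binary.PropositionalEquality using (_≡_; _≢_; refl; sym; trans; cong; cong₂; subst; subst₂; module ≡-Reasoning)
open import Data.Product using (_×_; _,_; ∃; ∃₂; uncurry; proj₁; proj₂)
open import Data.Sum using (_⊎_; inj₁; inj₂; [_,_]′)
open import Relation.Nullary using (¬_; yes; no; contradiction)
open import Data.Nat using (ℕ; zero; suc; z≤n; s≤s)
open import Data.Nat.Induction using (<-rec)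
import Data.Nat as ℕ
import Data.Nat.Properties as ℕ
import Data.Nat.Divisibility as ℕ
import Data.Nat.Tactic.RingSolver as ℕ-Solver

-- Neither quadratic argument factors b or c. Whether 2 is a square is settled by descent on the
-- modulus itself, which asks for no primality, so b = p q is treated like any odd number. In ℤ[i],
-- unique factorisation is replaced by Bézout identities: some γ = u + iv of norm c dividing δ = X +
-- i comes from another descent, and an identity γ A + δ̄ B = 1, available because δ - δ̄ = 2i and c
-- is odd, allows γ to be divided out again and again. For odd k this leaves X + i = γᵏ ε with ε of
-- norm 2. As in γ (1 + i) = (u - v) + (u + v) i, the numbers u + v and u - v then divide X and 1 in
-- some order. The one dividing 1 is ±1, and (u + v)² + (u - v)² = 2c becomes w² + 1 = 2c. Since c
-- need not be prime, the two representations p² + q² = w² + 1 of 2c do not contradict each other by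
-- themselves; they do so only through the divisibility w ∣ (p q)ˡ.

-- Division in ℤ[i] and the equation X² + 1 = 2 cᵏ for odd k

module GaussianIntegers where
  open import Data.Integer hiding (suc)
  open import Data.Integer.Properties
  open import Data.Integer.Divisibility.Signed
  open import Data.Integer.DivMod using (a≡a%ℕn+[a/ℕn]*n; n%ℕd<d)
  open import Data.Integer.Tactic.RingSolver using (solve-∀)

  -- (u + iv)(s + it) = X + i with u + iv of norm c.
  record Splits (c : ℕ) (X : ℤ) : Set where
    constructor splits
    field
      u v s t : ℤ
      norm≡ : u * u + v * v ≡ + c
      re≡   : u * s - v * t ≡ X
      im≡   : u * t + v * s ≡ 1ℤ

  norm-* : ∀ u v s t → (u * s - v * t) * (u * s - v * t) + (u * t + v * s) * (u * t + v * s)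
                     ≡ (u * u + v * v) * (s * s + t * t)
  norm-* = solve-∀

  pos-square+1 : ∀ r → + r * + r + 1ℤ ≡ + (r ℕ.* r ℕ.+ 1)
  pos-square+1 r = cong (_+ 1ℤ) (sym (pos-* r r))

  -- Reducing X modulo c yields r with r² + 1 = d c and d < c; the cofactor of a divisor of r + i
  -- of norm d has norm c.
  splits-of-∣ : ∀ c .{{_ : ℕ.NonZero c}} X → + c ∣ X * X + 1ℤ → Splits c X
  splits-of-∣ c = <-rec (λ c → .{{_ : ℕ.NonZero c}} → ∀ X → + c ∣ X * X + 1ℤ → Splits c X) go c
    where
    reduce : ∀ r j c q → (r + j * c) * (r + j * c) + 1ℤ ≡ q * c
           → r * r + 1ℤ ≡ (q - + 2 * (r * j) - j * j * c) * c
    reduce r j c q eq = begin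
      r * r + 1ℤ ≡⟨ expand r j c ⟩
      ((r + j * c) * (r + j * c) + 1ℤ) - (+ 2 * (r * j) + j * j * c) * c ≡⟨ cong (_- _) eq ⟩
      q * c - (+ 2 * (r * j) + j * j * c) * c ≡⟨ collect q r j c ⟩
      (q - + 2 * (r * j) - j * j * c) * c ∎
      where
      open ≡-Reasoning
      expand : ∀ r j c → r * r + 1ℤ ≡ ((r + j * c) * (r + j * c) + 1ℤ) - (+ 2 * (r * j) + j * j * c) * c
      expand = solve-∀
      collect : ∀ q r j c → q * c - (+ 2 * (r * j) + j * j * c) * c ≡ (q - + 2 * (r * j) - j * j * c) * c
      collect = solve-∀

    swap-re : ∀ u v s t j → s * (u + j * s) - t * (v - j * t) ≡ (u * s - v * t) + j * (s * s + t * t)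
    swap-re = solve-∀

    swap-im : ∀ u v s t j → s * (v - j * t) + t * (u + j * s) ≡ u * t + v * s
    swap-im = solve-∀

    smaller : ∀ d c r → r ℕ.< 2 ℕ.+ c → r ℕ.* r ℕ.+ 1 ≡ d ℕ.* (2 ℕ.+ c) → d ℕ.< 2 ℕ.+ c
    smaller d c r (s≤s r≤1+c) eq = ℕ.*-cancelʳ-< (2 ℕ.+ c) d (2 ℕ.+ c) (begin-strict
      d ℕ.* (2 ℕ.+ c)               ≡⟨ eq ⟨
      r ℕ.* r ℕ.+ 1                 ≤⟨ ℕ.+-monoˡ-≤ 1 (ℕ.*-mono-≤ r≤1+c r≤1+c) ⟩
      (1 ℕ.+ c) ℕ.* (1 ℕ.+ c) ℕ.+ 1 ≡⟨ ℕ.+-comm _ 1 ⟩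
      1 ℕ.+ (1 ℕ.+ c) ℕ.* (1 ℕ.+ c) <⟨ ℕ.+-mono-<-≤ (s≤s (s≤s z≤n)) (ℕ.*-monoʳ-≤ (1 ℕ.+ c) (ℕ.n≤1+n (1 ℕ.+ c))) ⟩
      (2 ℕ.+ c) ℕ.+ (1 ℕ.+ c) ℕ.* (2 ℕ.+ c) ∎)
      where open ℕ.≤-Reasoning

    go : ∀ c → (∀ {d} → d ℕ.< c → .{{_ : ℕ.NonZero d}} → ∀ X → + d ∣ X * X + 1ℤ → Splits d X)
       → .{{_ : ℕ.NonZero c}} → ∀ X → + c ∣ X * X + 1ℤ → Splits c X
    -- The descent stalls at c = 1, where r = 0 and d = 1 again, so this is the base case.
    go 1 _ X _ = splits 1ℤ 0ℤ X 1ℤ refl (re X) (im X)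
      where
      re : ∀ X → 1ℤ * X - 0ℤ * 1ℤ ≡ X
      re = solve-∀
      im : ∀ X → 1ℤ * 1ℤ + 0ℤ * X ≡ 1ℤ
      im = solve-∀
    go c@(suc (suc c′)) rec X (divides q eq) = from-ℕ (∣⇒∣ᵤ c∣)
      where
      r = X %ℕ c
      j = X /ℕ c
      X≡ : X ≡ + r + j * + c
      X≡ = a≡a%ℕn+[a/ℕn]*n X c
      c∣ : + c ∣ + (r ℕ.* r ℕ.+ 1)
      c∣ = subst (+ c ∣_) (pos-square+1 r)
             (divides (q - + 2 * (+ r * j) - j * j * + c) (reduce (+ r) j (+ c) q (subst (λ Y → Y * Y + 1ℤ ≡ q * + c) X≡ eq)))
      from-ℕ : c ℕ.∣ r ℕ.* r ℕ.+ 1 → Splits c X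
      from-ℕ (ℕ.divides zero e) with () ← trans (ℕ.+-comm 1 (r ℕ.* r)) e
      from-ℕ (ℕ.divides d@(suc _) e) with rec {d} (smaller d c′ r (n%ℕd<d X c) e) (+ r) d∣
        where
        d∣ : + d ∣ + r * + r + 1ℤ
        d∣ = subst (+ d ∣_) (sym (pos-square+1 r)) (∣ᵤ⇒∣ (ℕ.divides c (trans e (ℕ.*-comm d c))))
      -- Here X + i = (r + i) + j c and c = (s + it)(s - it), so the cofactor of s + it in X + i is
      -- (u + iv) + j (s - it).
      ... | splits u v s t norm≡ re≡ im≡ = splits s t (u + j * s) (v - j * t) norm′
            (begin
              s * (u + j * s) - t * (v - j * t)        ≡⟨ swap-re u v s t j ⟩
              (u * s - v * t) + j * (s * s + t * t)    ≡⟨ cong₂ (λ a b → a + j * b) re≡ norm′ ⟩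
              + r + j * + c                            ≡⟨ X≡ ⟨
              X                                        ∎)
            (trans (swap-im u v s t j) im≡)
        where
        open ≡-Reasoning
        norm′ : s * s + t * t ≡ + c
        norm′ = *-cancelˡ-≡ (+ d) _ _ (begin
          + d * (s * s + t * t)             ≡⟨ cong (_* (s * s + t * t)) norm≡ ⟨
          (u * u + v * v) * (s * s + t * t) ≡⟨ norm-* u v s t ⟨
          (u * s - v * t) * (u * s - v * t) + (u * t + v * s) * (u * t + v * s)
                                            ≡⟨ cong₂ (λ a b → a * a + b * b) re≡ im≡ ⟩
          + r * + r + 1ℤ                    ≡⟨ pos-square+1 r ⟩
          + (r ℕ.* r ℕ.+ 1)                 ≡⟨ cong +_ e ⟩
          + (d ℕ.* c)                       ≡⟨ pos-* d c ⟩
          + d * + c                         ∎)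

  -- γ A + δ̄ B = 1 for γ = u + iv, δ = s + it, A = a₁ + i a₂ and B = b₁ + i b₂.
  record Coprimality (u v s t : ℤ) : Set where
    constructor bezout
    field
      a₁ a₂ b₁ b₂ : ℤ
      re≡ : (u * a₁ - v * a₂) + (s * b₁ + t * b₂) ≡ 1ℤ
      im≡ : (u * a₂ + v * a₁) + (s * b₂ - t * b₁) ≡ 0ℤ

  record Cofactor (u v s t : ℤ) : Set where
    constructor cofactor
    field
      s′ t′ : ℤ
      s≡ : s ≡ u * s′ - v * t′
      t≡ : t ≡ u * t′ + v * s′
      coprime : Coprimality u v s′ t′

  -- Substituting δ δ̄ = f γ γ̄ in δ = γ A δ + δ̄ B δ exhibits the factor γ.
  divide : ∀ u v s t f → Coprimality u v s t → s * s + t * t ≡ f * (u * u + v * v) → Cofactor u v s t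
  divide u v s t f (bezout a₁ a₂ b₁ b₂ re≡ im≡) norm≡ =
    -- With δ = γ δ′ the term δ̄ B is δ̄′ (γ̄ B), so the identity survives for δ′ with B replaced by
    -- γ̄ B. This is what permits repeated division.
    cofactor s′ t′ s≡ t≡ (bezout a₁ a₂ (b₁ * u + b₂ * v) (b₂ * u - b₁ * v) re′ im′)
    where
    open ≡-Reasoning
    s′ t′ : ℤ
    s′ = (a₁ * s - a₂ * t) + f * (b₁ * u + b₂ * v)
    t′ = (a₁ * t + a₂ * s) + f * (b₂ * u - b₁ * v)
    s-expand : ∀ u v s t f a₁ a₂ b₁ b₂ →
      u * ((a₁ * s - a₂ * t) + f * (b₁ * u + b₂ * v)) - v * ((a₁ * t + a₂ * s) + f * (b₂ * u - b₁ * v))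
      ≡ s * ((u * a₁ - v * a₂) + (s * b₁ + t * b₂)) - t * ((u * a₂ + v * a₁) + (s * b₂ - t * b₁))
        + b₁ * (f * (u * u + v * v) - (s * s + t * t))
    s-expand = solve-∀
    t-expand : ∀ u v s t f a₁ a₂ b₁ b₂ →
      u * ((a₁ * t + a₂ * s) + f * (b₂ * u - b₁ * v)) + v * ((a₁ * s - a₂ * t) + f * (b₁ * u + b₂ * v))
      ≡ t * ((u * a₁ - v * a₂) + (s * b₁ + t * b₂)) + s * ((u * a₂ + v * a₁) + (s * b₂ - t * b₁))
        + b₂ * (f * (u * u + v * v) - (s * s + t * t))
    t-expand = solve-∀
    s-collapse : ∀ s t b n → s * 1ℤ - t * 0ℤ + b * (n - n) ≡ s
    s-collapse = solve-∀
    t-collapse : ∀ s t b n → t * 1ℤ + s * 0ℤ + b * (n - n) ≡ t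
    t-collapse = solve-∀
    s≡ : s ≡ u * s′ - v * t′
    s≡ = sym (begin
      u * s′ - v * t′ ≡⟨ s-expand u v s t f a₁ a₂ b₁ b₂ ⟩
      _ ≡⟨ cong₂ (λ x y → s * x - t * y + b₁ * (f * (u * u + v * v) - (s * s + t * t))) re≡ im≡ ⟩
      s * 1ℤ - t * 0ℤ + b₁ * (f * (u * u + v * v) - (s * s + t * t))
        ≡⟨ cong (λ n → s * 1ℤ - t * 0ℤ + b₁ * (f * (u * u + v * v) - n)) norm≡ ⟩
      _ ≡⟨ s-collapse s t b₁ (f * (u * u + v * v)) ⟩
      s ∎)
    t≡ : t ≡ u * t′ + v * s′
    t≡ = sym (begin
      u * t′ + v * s′ ≡⟨ t-expand u v s t f a₁ a₂ b₁ b₂ ⟩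
      _ ≡⟨ cong₂ (λ x y → t * x + s * y + b₂ * (f * (u * u + v * v) - (s * s + t * t))) re≡ im≡ ⟩
      t * 1ℤ + s * 0ℤ + b₂ * (f * (u * u + v * v) - (s * s + t * t))
        ≡⟨ cong (λ n → t * 1ℤ + s * 0ℤ + b₂ * (f * (u * u + v * v) - n)) norm≡ ⟩
      _ ≡⟨ t-collapse s t b₂ (f * (u * u + v * v)) ⟩
      t ∎)
    re-shift : ∀ u v s t a b₁ b₂ → a + (s * (b₁ * u + b₂ * v) + t * (b₂ * u - b₁ * v))
                                 ≡ a + ((u * s - v * t) * b₁ + (u * t + v * s) * b₂)
    re-shift = solve-∀
    im-shift : ∀ u v s t a b₁ b₂ → a + (s * (b₂ * u - b₁ * v) - t * (b₁ * u + b₂ * v))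
                                 ≡ a + ((u * s - v * t) * b₂ - (u * t + v * s) * b₁)
    im-shift = solve-∀
    re′ : (u * a₁ - v * a₂) + (s′ * (b₁ * u + b₂ * v) + t′ * (b₂ * u - b₁ * v)) ≡ 1ℤ
    re′ = begin
      _ ≡⟨ re-shift u v s′ t′ (u * a₁ - v * a₂) b₁ b₂ ⟩
      _ ≡⟨ cong₂ (λ x y → (u * a₁ - v * a₂) + (x * b₁ + y * b₂)) (sym s≡) (sym t≡) ⟩
      _ ≡⟨ re≡ ⟩
      1ℤ ∎
    im′ : (u * a₂ + v * a₁) + (s′ * (b₂ * u - b₁ * v) - t′ * (b₁ * u + b₂ * v)) ≡ 0ℤ
    im′ = begin
      _ ≡⟨ im-shift u v s′ t′ (u * a₂ + v * a₁) b₁ b₂ ⟩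
      _ ≡⟨ cong₂ (λ x y → (u * a₂ + v * a₁) + (x * b₂ - y * b₁)) (sym s≡) (sym t≡) ⟩
      _ ≡⟨ im≡ ⟩
      0ℤ ∎

  ∣i∣≡1⇒i²≡1 : ∀ i → ∣ i ∣ ≡ 1 → i * i ≡ 1ℤ
  ∣i∣≡1⇒i²≡1 (+ 1)    refl = refl
  ∣i∣≡1⇒i²≡1 -[1+ 0 ] refl = refl

  i*i≡+∣i∣*∣i∣ : ∀ i → i * i ≡ + (∣ i ∣ ℕ.* ∣ i ∣)
  i*i≡+∣i∣*∣i∣ (+ n)    = sym (pos-* n n)
  i*i≡+∣i∣*∣i∣ -[1+ n ] = refl

  pos-^ : ∀ m k → + (m ℕ.^ k) ≡ (+ m) ^ k
  pos-^ m zero    = refl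
  pos-^ m (suc k) = trans (pos-* m (m ℕ.^ k)) (cong (+ m *_) (pos-^ m k))

  squares-sum-to-2 : ∀ a b → a ℕ.* a ℕ.+ b ℕ.* b ≡ 2 → a ≡ 1 × b ≡ 1
  squares-sum-to-2 a b eq = cases a b (≤1 a (b ℕ.* b) eq) (≤1 b (a ℕ.* a) (trans (ℕ.+-comm (b ℕ.* b) _) eq)) eq
    where
    ≤1 : ∀ x y → x ℕ.* x ℕ.+ y ≡ 2 → x ℕ.≤ 1
    ≤1 x y e with x ℕ.≤? 1
    ... | yes x≤1 = x≤1
    ... | no  x≰1 with s≤s (s≤s ()) ← ℕ.≤-trans (ℕ.*-mono-≤ (ℕ.≰⇒> x≰1) (ℕ.≰⇒> x≰1)) (ℕ.≤-trans (ℕ.m≤m+n _ y) (ℕ.≤-reflexive e))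
    cases : ∀ x y → x ℕ.≤ 1 → y ℕ.≤ 1 → x ℕ.* x ℕ.+ y ℕ.* y ≡ 2 → x ≡ 1 × y ≡ 1
    cases 1 1 _ _ _ = refl , refl
    cases 0 0 _ _ ()
    cases 0 1 _ _ ()
    cases 1 0 _ _ ()
    cases (suc (suc _)) _ (s≤s ()) _ _
    cases _ (suc (suc _)) _ (s≤s ()) _

  norm-2 : ∀ s t → s * s + t * t ≡ + 2 → t ≡ s ⊎ t ≡ - s
  norm-2 s t eq = uncurry (units s t) (squares-sum-to-2 ∣ s ∣ ∣ t ∣
    (+-injective (trans (cong₂ _+_ (sym (i*i≡+∣i∣*∣i∣ s)) (sym (i*i≡+∣i∣*∣i∣ t))) eq)))
    where
    units : ∀ s t → ∣ s ∣ ≡ 1 → ∣ t ∣ ≡ 1 → t ≡ s ⊎ t ≡ - s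
    units (+ 1)    (+ 1)    refl refl = inj₁ refl
    units (+ 1)    -[1+ 0 ] refl refl = inj₂ refl
    units -[1+ 0 ] (+ 1)    refl refl = inj₂ refl
    units -[1+ 0 ] -[1+ 0 ] refl refl = inj₁ refl

  -- The divisibility pattern of γ (1 + i) = (u - v) + (u + v) i and, in the other order, of i times
  -- this number.
  Aligned : (u v s t : ℤ) → Set
  Aligned u v s t = ((u + v ∣ s) × (u - v ∣ t)) ⊎ ((u - v ∣ s) × (u + v ∣ t))

  aligned-norm-2 : ∀ u v e f → f ≡ e ⊎ f ≡ - e → Aligned u v (u * e - v * f) (u * f + v * e)
  aligned-norm-2 u v e f (inj₁ refl) = inj₂ (divides e (re u v e) , divides e (im u v e))
    where
    re : ∀ u v e → u * e - v * e ≡ e * (u - v)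
    re = solve-∀
    im : ∀ u v e → u * e + v * e ≡ e * (u + v)
    im = solve-∀
  aligned-norm-2 u v e f (inj₂ refl) = inj₁ (divides e (re u v e) , divides (- e) (im u v e))
    where
    re : ∀ u v e → u * e - v * (- e) ≡ e * (u + v)
    re = solve-∀
    im : ∀ u v e → u * (- e) + v * e ≡ - e * (u - v)
    im = solve-∀

  -- In γ² = (u² - v²) + 2uv i the real part vanishes modulo u + v and modulo u - v, so
  -- multiplication by γ² exchanges the two alternatives.
  aligned-square : ∀ u v s t → Aligned u v s t →
    Aligned u v (u * (u * s - v * t) - v * (u * t + v * s)) (u * (u * t + v * s) + v * (u * s - v * t))
  aligned-square u v s t (inj₁ (divides k refl , divides l refl)) =
    inj₂ (divides ((u + v) * (u + v) * k - + 2 * u * v * l) (re u v k l)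
         , divides ((u - v) * (u - v) * l + + 2 * u * v * k) (im u v k l))
    where
    re : ∀ u v k l → u * (u * (k * (u + v)) - v * (l * (u - v))) - v * (u * (l * (u - v)) + v * (k * (u + v)))
       ≡ ((u + v) * (u + v) * k - + 2 * u * v * l) * (u - v)
    re = solve-∀
    im : ∀ u v k l → u * (u * (l * (u - v)) + v * (k * (u + v))) + v * (u * (k * (u + v)) - v * (l * (u - v)))
       ≡ ((u - v) * (u - v) * l + + 2 * u * v * k) * (u + v)
    im = solve-∀
  aligned-square u v s t (inj₂ (divides k refl , divides l refl)) =
    inj₁ (divides ((u - v) * (u - v) * k - + 2 * u * v * l) (re u v k l)
         , divides ((u + v) * (u + v) * l + + 2 * u * v * k) (im u v k l))
    where
    re : ∀ u v k l → u * (u * (k * (u - v)) - v * (l * (u + v))) - v * (u * (l * (u + v)) + v * (k * (u - v)))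
       ≡ ((u - v) * (u - v) * k - + 2 * u * v * l) * (u + v)
    re = solve-∀
    im : ∀ u v k l → u * (u * (l * (u + v)) + v * (k * (u - v))) + v * (u * (k * (u - v)) - v * (l * (u + v)))
       ≡ ((u + v) * (u + v) * l + + 2 * u * v * k) * (u - v)
    im = solve-∀

  module _ (c : ℕ) .{{_ : ℕ.NonZero c}} (u v : ℤ) (norm-γ : u * u + v * v ≡ + c) where

    divide-power : ∀ k s t → Coprimality u v s t → s * s + t * t ≡ + 2 * (+ c) ^ suc k
                 → ∃₂ λ s′ t′ → s ≡ u * s′ - v * t′ × t ≡ u * t′ + v * s′
                              × Coprimality u v s′ t′ × s′ * s′ + t′ * t′ ≡ + 2 * (+ c) ^ k
    divide-power k s t coprime norm-δ = from-cofactor (divide u v s t (+ 2 * (+ c) ^ k) coprime norm-δ′)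
      where
      open ≡-Reasoning
      shuffle : ∀ a b d → a * (b * d) ≡ a * d * b
      shuffle = solve-∀
      shuffle′ : ∀ a b d → a * (b * d) ≡ b * (a * d)
      shuffle′ = solve-∀
      norm-δ′ : s * s + t * t ≡ + 2 * (+ c) ^ k * (u * u + v * v)
      norm-δ′ = begin
        s * s + t * t                         ≡⟨ norm-δ ⟩
        + 2 * (+ c * (+ c) ^ k)               ≡⟨ shuffle (+ 2) (+ c) ((+ c) ^ k) ⟩
        + 2 * (+ c) ^ k * + c                 ≡⟨ cong (+ 2 * (+ c) ^ k *_) norm-γ ⟨
        + 2 * (+ c) ^ k * (u * u + v * v)     ∎
      +c≢0 : NonZero (+ c)
      +c≢0 = ≢-nonZero (λ +c≡0 → ℕ.≢-nonZero⁻¹ c (+-injective +c≡0))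
      from-cofactor : Cofactor u v s t
                    → ∃₂ λ s′ t′ → s ≡ u * s′ - v * t′ × t ≡ u * t′ + v * s′
                                 × Coprimality u v s′ t′ × s′ * s′ + t′ * t′ ≡ + 2 * (+ c) ^ k
      from-cofactor (cofactor s′ t′ s≡ t≡ coprime′) = s′ , t′ , s≡ , t≡ , coprime′ ,
        *-cancelˡ-≡ (+ c) (s′ * s′ + t′ * t′) (+ 2 * (+ c) ^ k) {{+c≢0}} (begin
          + c * (s′ * s′ + t′ * t′)               ≡⟨ cong (_* (s′ * s′ + t′ * t′)) norm-γ ⟨
          (u * u + v * v) * (s′ * s′ + t′ * t′)   ≡⟨ norm-* u v s′ t′ ⟨
          (u * s′ - v * t′) * (u * s′ - v * t′) + (u * t′ + v * s′) * (u * t′ + v * s′)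
                                                  ≡⟨ cong₂ (λ a b → a * a + b * b) s≡ t≡ ⟨
          s * s + t * t                           ≡⟨ norm-δ ⟩
          + 2 * (+ c * (+ c) ^ k)                 ≡⟨ shuffle′ (+ 2) (+ c) ((+ c) ^ k) ⟩
          + c * (+ 2 * (+ c) ^ k)                 ∎)

    -- Modulo u ± v, γ² is a rational integer times i, so γ^(2h+1) is aligned with γ up to a power of i.
    aligned-odd-power : ∀ h s t → Coprimality u v s t → s * s + t * t ≡ + 2 * (+ c) ^ suc (h ℕ.* 2)
                      → Aligned u v s t
    aligned-odd-power zero s t coprime norm-δ =
      let e , f , s≡ , t≡ , _ , norm-ε = divide-power 0 s t coprime norm-δ
      in subst₂ (Aligned u v) (sym s≡) (sym t≡) (aligned-norm-2 u v e f (norm-2 e f norm-ε))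
    aligned-odd-power (suc h) s t coprime norm-δ =
      let s′ , t′ , s≡ , t≡ , coprime′ , norm-δ′ = divide-power (suc (suc (h ℕ.* 2))) s t coprime norm-δ
          s″ , t″ , s′≡ , t′≡ , coprime″ , norm-δ″ = divide-power (suc (h ℕ.* 2)) s′ t′ coprime′ norm-δ′
      in subst₂ (Aligned u v)
           (sym (trans s≡ (cong₂ (λ a b → u * a - v * b) s′≡ t′≡)))
           (sym (trans t≡ (cong₂ (λ a b → u * b + v * a) s′≡ t′≡)))
           (aligned-square u v s″ t″ (aligned-odd-power h s″ t″ coprime″ norm-δ″))

  -- Alignment is applied to δ = X + i itself: the imaginary part 1 forces one of u + v, u - v to be
  -- a unit, and the other one is w.
  X²+1≡2c^odd⇒w²+1≡2cℤ : ∀ c .{{_ : ℕ.NonZero c}} h X e → + c ≡ 1ℤ + + 2 * e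
              → X * X + 1ℤ ≡ + 2 * (+ c) ^ suc (h ℕ.* 2)
              → ∃ λ w → w * w + 1ℤ ≡ + 2 * + c × (w ∣ X)
  X²+1≡2c^odd⇒w²+1≡2cℤ c h X e c≡ eq = from-splits (splits-of-∣ c X c∣)
    where
    open ≡-Reasoning
    shuffle : ∀ a b d → a * (b * d) ≡ a * d * b
    shuffle = solve-∀
    c∣ : + c ∣ X * X + 1ℤ
    c∣ = divides (+ 2 * (+ c) ^ (h ℕ.* 2)) (trans eq (shuffle (+ 2) (+ c) ((+ c) ^ (h ℕ.* 2))))
    re-expand : ∀ u v e s t X → (u * (u - e * t) - v * (- v + e * s)) + (X * 0ℤ + 1ℤ * (- e))
              ≡ (u * u + v * v) - e * (u * t + v * s) - e
    re-expand = solve-∀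
    re-collapse : ∀ e → 1ℤ + + 2 * e - e * 1ℤ - e ≡ 1ℤ
    re-collapse = solve-∀
    im-expand : ∀ u v e s t X → (u * (- v + e * s) + v * (u - e * t)) + (X * (- e) - 1ℤ * 0ℤ)
              ≡ e * (u * s - v * t) - e * X
    im-expand = solve-∀
    im-collapse : ∀ e X → e * X - e * X ≡ 0ℤ
    im-collapse = solve-∀
    parallelogram : ∀ u v → (u + v) * (u + v) + (u - v) * (u - v) ≡ + 2 * (u * u + v * v)
    parallelogram = solve-∀

    module _ (u v : ℤ) (norm≡ : u * u + v * v ≡ + c) where
      square+1 : ∀ w w′ → w * w + w′ * w′ ≡ + 2 * (u * u + v * v) → w′ ∣ 1ℤ → w * w + 1ℤ ≡ + 2 * + c
      square+1 w w′ w²+w′² w′∣1 = begin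
        w * w + 1ℤ              ≡⟨ cong (λ a → w * w + a) (∣i∣≡1⇒i²≡1 w′ (ℕ.∣1⇒≡1 (∣⇒∣ᵤ w′∣1))) ⟨
        w * w + w′ * w′         ≡⟨ w²+w′² ⟩
        + 2 * (u * u + v * v)   ≡⟨ cong (+ 2 *_) norm≡ ⟩
        + 2 * + c               ∎

      from-aligned : Aligned u v X 1ℤ → ∃ λ w → w * w + 1ℤ ≡ + 2 * + c × (w ∣ X)
      from-aligned (inj₁ (u+v∣X , u-v∣1)) = u + v , square+1 (u + v) (u - v) (parallelogram u v) u-v∣1 , u+v∣X
      from-aligned (inj₂ (u-v∣X , u+v∣1)) =
        u - v , square+1 (u - v) (u + v) (trans (+-comm ((u - v) * (u - v)) ((u + v) * (u + v))) (parallelogram u v)) u+v∣1 , u-v∣X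

    from-splits : Splits c X → ∃ λ w → w * w + 1ℤ ≡ + 2 * + c × (w ∣ X)
    from-splits (splits u v s t norm≡ re≡ im≡) = from-aligned u v norm≡
      -- The witnesses are A = γ̄ + e i (s + it) and B = -e i. As γ (s + it) = X + i, they give γ A
      -- + δ̄ B = c + e i ((X + i) - (X - i)) = c - 2e = 1.
      (aligned-odd-power c u v norm≡ h X 1ℤ (bezout (u - e * t) (- v + e * s) 0ℤ (- e) re im) eq)
      where
      re : (u * (u - e * t) - v * (- v + e * s)) + (X * 0ℤ + 1ℤ * (- e)) ≡ 1ℤ
      re = begin
        _                                               ≡⟨ re-expand u v e s t X ⟩
        (u * u + v * v) - e * (u * t + v * s) - e       ≡⟨ cong₂ (λ a b → a - e * b - e) (trans norm≡ c≡) im≡ ⟩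
        1ℤ + + 2 * e - e * 1ℤ - e                       ≡⟨ re-collapse e ⟩
        1ℤ                                              ∎
      im : (u * (- v + e * s) + v * (u - e * t)) + (X * (- e) - 1ℤ * 0ℤ) ≡ 0ℤ
      im = begin
        _                                               ≡⟨ im-expand u v e s t X ⟩
        e * (u * s - v * t) - e * X                     ≡⟨ cong (λ a → e * a - e * X) re≡ ⟩
        e * X - e * X                                   ≡⟨ im-collapse e X ⟩
        0ℤ                                              ∎

  -- A weak form of Størmer's theorem on X² + 1 = 2 cᵏ for odd k.
  X²+1≡2c^odd⇒w²+1≡2c : ∀ c h X e → c ≡ 1 ℕ.+ 2 ℕ.* e → X ℕ.* X ℕ.+ 1 ≡ 2 ℕ.* c ℕ.^ suc (h ℕ.* 2)
                      → ∃ λ w → w ℕ.* w ℕ.+ 1 ≡ 2 ℕ.* c × w ℕ.∣ X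
  X²+1≡2c^odd⇒w²+1≡2c c@(suc _) h X e c≡ eq =
    let w , w²≡ , w∣X = X²+1≡2c^odd⇒w²+1≡2cℤ c h (+ X) (+ e) (trans (cong +_ c≡) (cong (_+_ 1ℤ) (pos-* 2 e))) eqℤ
    in ∣ w ∣ , +-injective (begin
      + (∣ w ∣ ℕ.* ∣ w ∣) + 1ℤ          ≡⟨ cong (_+ 1ℤ) (i*i≡+∣i∣*∣i∣ w) ⟨
      w * w + 1ℤ                        ≡⟨ w²≡ ⟩
      + 2 * + c                         ≡⟨ pos-* 2 c ⟨
      + (2 ℕ.* c)                       ∎) , ∣⇒∣ᵤ w∣X
    where
    open ≡-Reasoning
    eqℤ : + X * + X + 1ℤ ≡ + 2 * (+ c) ^ suc (h ℕ.* 2)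
    eqℤ = begin
      + X * + X + 1ℤ                    ≡⟨ pos-square+1 X ⟩
      + (X ℕ.* X ℕ.+ 1)                 ≡⟨ cong +_ eq ⟩
      + (2 ℕ.* c ℕ.^ suc (h ℕ.* 2))     ≡⟨ pos-* 2 (c ℕ.^ suc (h ℕ.* 2)) ⟩
      + 2 * + (c ℕ.^ suc (h ℕ.* 2))     ≡⟨ cong (+ 2 *_) (pos-^ c (suc (h ℕ.* 2))) ⟩
      + 2 * (+ c) ^ suc (h ℕ.* 2)       ∎

-- The cofactor of P + Q in Pʳ + Qʳ for odd r

module SumsOfOddPowers where
  open GaussianIntegers using (pos-^)
  open import Data.Integer hiding (suc)
  open import Data.Integer.Properties
  open import Data.Integer.Divisibility.Signed
  open import Data.Integer.Tactic.RingSolver using (solve-∀)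

  -- The number t is the binomial coefficient of 2 + n over 2, pinned down by its double to avoid a
  -- division. The explicit D² term is needed because the cofactor, which has one factor D fewer, is
  -- studied modulo r² when r divides D.
  binomial₃ : ∀ P D n → ∃₂ λ (t : ℕ) E → 2 ℕ.* t ≡ (2 ℕ.+ n) ℕ.* (1 ℕ.+ n)
            × (P + D) ^ (2 ℕ.+ n) ≡ P ^ (2 ℕ.+ n) + + (2 ℕ.+ n) * P ^ (1 ℕ.+ n) * D
                                    + + t * P ^ n * (D * D) + E * (D * D * D)
  binomial₃ P D zero = 1 , 0ℤ , refl , expand P D
    where
    expand : ∀ P D → (P + D) * ((P + D) * 1ℤ)
           ≡ P * (P * 1ℤ) + + 2 * (P * 1ℤ) * D + 1ℤ * 1ℤ * (D * D) + 0ℤ * (D * D * D)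
    expand = solve-∀
  binomial₃ P D (suc n) =
    let t , E , 2t≡ , eq = binomial₃ P D n
    in t ℕ.+ (2 ℕ.+ n) , E * P + E * D + + t * P ^ n , double t n 2t≡ , (begin
      (P + D) * (P + D) ^ (2 ℕ.+ n)
        ≡⟨ cong ((P + D) *_) eq ⟩
      (P + D) * (P * (P * P ^ n) + + (2 ℕ.+ n) * (P * P ^ n) * D + + t * P ^ n * (D * D) + E * (D * D * D))
        ≡⟨ expand P D (P ^ n) (+ (2 ℕ.+ n)) (+ t) E ⟩
      P * (P * (P * P ^ n)) + (1ℤ + + (2 ℕ.+ n)) * (P * (P * P ^ n)) * D
        + (+ t + + (2 ℕ.+ n)) * (P * P ^ n) * (D * D) + (E * P + E * D + + t * P ^ n) * (D * D * D) ∎)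
    where
    open ≡-Reasoning
    expand : ∀ P D Z r t E →
      (P + D) * (P * (P * Z) + r * (P * Z) * D + t * Z * (D * D) + E * (D * D * D))
      ≡ P * (P * (P * Z)) + (1ℤ + r) * (P * (P * Z)) * D
        + (t + r) * (P * Z) * (D * D) + (E * P + E * D + t * Z) * (D * D * D)
    expand = solve-∀
    double : ∀ t n → 2 ℕ.* t ≡ (2 ℕ.+ n) ℕ.* (1 ℕ.+ n) → 2 ℕ.* (t ℕ.+ (2 ℕ.+ n)) ≡ (3 ℕ.+ n) ℕ.* (2 ℕ.+ n)
    double t n eq = trans (ℕ.*-distribˡ-+ 2 t (2 ℕ.+ n)) (trans (cong (ℕ._+ 2 ℕ.* (2 ℕ.+ n)) eq) (collect n))
      where
      collect : ∀ n → (2 ℕ.+ n) ℕ.* (1 ℕ.+ n) ℕ.+ 2 ℕ.* (2 ℕ.+ n) ≡ (3 ℕ.+ n) ℕ.* (2 ℕ.+ n)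
      collect = ℕ-Solver.solve-∀

  neg-odd-power : ∀ Q h → (- Q) ^ suc (h ℕ.* 2) ≡ - (Q ^ suc (h ℕ.* 2))
  neg-odd-power Q zero = flip Q
    where
    flip : ∀ Q → - Q * 1ℤ ≡ - (Q * 1ℤ)
    flip = solve-∀
  neg-odd-power Q (suc h) = trans (cong (λ Z → - Q * (- Q * Z)) (neg-odd-power Q h)) (flip Q (Q ^ suc (h ℕ.* 2)))
    where
    flip : ∀ Q Z → - Q * (- Q * - Z) ≡ - (Q * (Q * Z))
    flip = solve-∀

  -- The cofactor σ of P + Q in Pʳ + Qʳ: modulo P + Q it is r P^(r-1), and if r divides P + Q this
  -- holds even modulo r², because r then divides the binomial coefficient r (r - 1) / 2.
  record OddCofactor (P Q h : ℕ) : Set where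
    r : ℕ
    r = suc (h ℕ.* 2)
    field
      σ       : ℕ
      factors : P ℕ.^ r ℕ.+ Q ℕ.^ r ≡ (P ℕ.+ Q) ℕ.* σ
      common  : ∀ s → s ℕ.∣ P ℕ.+ Q → s ℕ.∣ σ → s ℕ.∣ r ℕ.* P ℕ.^ (h ℕ.* 2)
      square  : r ℕ.∣ P ℕ.+ Q → r ℕ.* r ℕ.∣ σ → r ℕ.* r ℕ.∣ r ℕ.* P ℕ.^ (h ℕ.* 2)

  -- For D = -(P + Q) one has P + D = -Q, and r is odd, so Pʳ + Qʳ = Pʳ - (P + D)ʳ. The expansion
  -- then has D as a factor, and S is what remains. Passing to the absolute value of S is harmless
  -- since Pʳ + Qʳ and P + Q are natural numbers.
  odd-cofactor : ∀ P Q h → OddCofactor P Q (suc h)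
  odd-cofactor P Q h = record
    { σ       = ∣ S ∣
    ; factors = factors
    ; common  = λ s s∣P+Q s∣σ → ∣⇒∣ᵤ (subst (+ s ∣_) (sym rP≡) (remainder (+ s)
                  (∣n⇒∣m*n (+ t * (+ P) ^ n + E * D) (∣D s s∣P+Q)) (∣ᵤ⇒∣ {+ s} {S} s∣σ)))
    ; square  = λ r∣P+Q r²∣σ → ∣⇒∣ᵤ (subst (+ (r ℕ.* r) ∣_) (sym rP≡) (remainder (+ (r ℕ.* r))
                  (subst (_∣ (+ t * (+ P) ^ n + E * D) * D) (sym (pos-* r r)) (r²∣ (∣D r r∣P+Q)))
                  (∣ᵤ⇒∣ {+ (r ℕ.* r)} {S} r²∣σ)))
    }
    where
    n r : ℕ
    n = suc (h ℕ.* 2)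
    r = 2 ℕ.+ n
    D : ℤ
    D = - (+ P + + Q)
    expansion = binomial₃ (+ P) D n
    t : ℕ
    t = proj₁ expansion
    E S : ℤ
    E = proj₁ (proj₂ expansion)
    2t≡ : 2 ℕ.* t ≡ (2 ℕ.+ n) ℕ.* (1 ℕ.+ n)
    2t≡ = proj₁ (proj₂ (proj₂ expansion))
    S = + r * (+ P) ^ (1 ℕ.+ n) + (+ t * (+ P) ^ n + E * D) * D

    t≡ : t ≡ suc h ℕ.* r
    t≡ = ℕ.*-cancelˡ-≡ t (suc h ℕ.* r) 2 (trans 2t≡ (collect h))
      where
      collect : ∀ h → (3 ℕ.+ h ℕ.* 2) ℕ.* (2 ℕ.+ h ℕ.* 2) ≡ 2 ℕ.* ((1 ℕ.+ h) ℕ.* (3 ℕ.+ h ℕ.* 2))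
      collect = ℕ-Solver.solve-∀

    factorsℤ : (+ P) ^ r + (+ Q) ^ r ≡ (+ P + + Q) * S
    factorsℤ = begin
      (+ P) ^ r + (+ Q) ^ r                ≡⟨ double-neg ((+ P) ^ r) ((+ Q) ^ r) ⟩
      (+ P) ^ r - - ((+ Q) ^ r)            ≡⟨ cong (λ x → (+ P) ^ r - x) (neg-odd-power (+ Q) (suc h)) ⟨
      (+ P) ^ r - (- + Q) ^ r              ≡⟨ cong (λ x → (+ P) ^ r - x ^ r) (cancel (+ P) (+ Q)) ⟨
      (+ P) ^ r - (+ P + D) ^ r            ≡⟨ cong (λ x → (+ P) ^ r - x) (proj₂ (proj₂ (proj₂ expansion))) ⟩
      (+ P) ^ r - ((+ P) ^ r + + r * (+ P) ^ (1 ℕ.+ n) * D + + t * (+ P) ^ n * (D * D) + E * (D * D * D))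
        ≡⟨ collect ((+ P) ^ r) (+ r) ((+ P) ^ (1 ℕ.+ n)) (+ t) ((+ P) ^ n) E (+ P + + Q) ⟩
      (+ P + + Q) * S                      ∎
      where
      open ≡-Reasoning
      double-neg : ∀ x y → x + y ≡ x - - y
      double-neg = solve-∀
      cancel : ∀ x y → x - (x + y) ≡ - y
      cancel = solve-∀
      collect : ∀ X r Y t Z E D → X - (X + r * Y * - D + t * Z * (- D * - D) + E * (- D * - D * - D))
                                ≡ D * (r * Y + (t * Z + E * - D) * - D)
      collect = solve-∀

    factors : P ℕ.^ r ℕ.+ Q ℕ.^ r ≡ (P ℕ.+ Q) ℕ.* ∣ S ∣
    factors = trans (cong ∣_∣ (trans (cong₂ _+_ (pos-^ P r) (pos-^ Q r)) factorsℤ)) (abs-* (+ P + + Q) S)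

    rP≡ : + (r ℕ.* P ℕ.^ (1 ℕ.+ n)) ≡ + r * (+ P) ^ (1 ℕ.+ n)
    rP≡ = trans (pos-* r (P ℕ.^ (1 ℕ.+ n))) (cong (+ r *_) (pos-^ P (1 ℕ.+ n)))

    ∣D : ∀ s → s ℕ.∣ P ℕ.+ Q → + s ∣ D
    ∣D s s∣ = ∣m⇒∣-m (∣ᵤ⇒∣ {+ s} {+ P + + Q} s∣)

    remainder : ∀ s → s ∣ (+ t * (+ P) ^ n + E * D) * D → s ∣ S → s ∣ + r * (+ P) ^ (1 ℕ.+ n)
    remainder s s∣tail s∣S = ∣m+n∣n⇒∣m {m = + r * (+ P) ^ (1 ℕ.+ n)} s∣S s∣tail

    r²∣ : + r ∣ D → + r * + r ∣ (+ t * (+ P) ^ n + E * D) * D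
    r²∣ (divides d D≡) = divides ((+ suc h * (+ P) ^ n + E * d) * d) (begin
      (+ t * (+ P) ^ n + E * D) * D
        ≡⟨ cong₂ (λ x y → (x * (+ P) ^ n + E * y) * y) (trans (cong +_ t≡) (pos-* (suc h) r)) D≡ ⟩
      (+ suc h * + r * (+ P) ^ n + E * (d * + r)) * (d * + r)
        ≡⟨ collect (+ suc h) (+ r) ((+ P) ^ n) E d ⟩
      (+ suc h * (+ P) ^ n + E * d) * d * (+ r * + r) ∎)
      where
      open ≡-Reasoning
      collect : ∀ a r Z E d → (a * r * Z + E * (d * r)) * (d * r) ≡ (a * Z + E * d) * d * (r * r)
      collect = solve-∀

open GaussianIntegers using (X²+1≡2c^odd⇒w²+1≡2c)
open SumsOfOddPowers using (OddCofactor; odd-cofactor)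
open import Data.Nat using (_+_; _*_; _∸_; _^_; _≤_; _<_; _%_; _/_; NonZero; nonTrivial⇒≢1; nonTrivial⇒n>1; >-nonZero; >-nonZero⁻¹)
open import Data.Nat.GCD using (gcd; module Bézout)
open import Data.Nat.Primality using (Prime; prime[2]; euclidsLemma; prime⇒irreducible; prime⇒nonZero; prime⇒nonTrivial)
open import Data.Nat.Properties
open import Data.Nat.Divisibility
open import Data.Nat.DivMod using (m≡m%n+[m/n]*n; m%n<n; %-distribˡ-+; %-distribˡ-*; m∣n⇒o%n%m≡o%m)
open import Data.Nat.Coprimality using (Coprime; coprime-divisor; coprime-Bézout; gcd≡1⇒coprime) renaming (sym to coprime-sym)
open import Data.Nat.Primality.Factorisation using (factorise)
open import Data.Nat.Tactic.RingSolver using (solve-∀)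
open import Data.Fin using (Fin; toℕ; fromℕ<)
open import Data.Fin.Properties using (all?; toℕ-fromℕ<)
open import Data.List using ([]; _∷_)
open import Data.List.Relation.Unary.All using (_∷_)
open import Relation.Binary.Definitions using (tri<; tri≈; tri>)
open import Relation.Nullary.Decidable using (from-yes; _⊎-dec_; _→-dec_)
import Data.Integer as ℤ
import Data.Integer.Properties as ℤ
import Data.Integer.Divisibility.Signed as ℤ
import Data.Integer.DivMod as ℤ
import Data.Integer.Tactic.RingSolver as ℤ-Solver

-- Parity, powers and squares of natural numbers

parity : ∀ n → ∃ λ h → n ≡ h * 2 ⊎ n ≡ suc (h * 2)
parity zero = zero , inj₁ refl
parity (suc n) with parity n
... | h , inj₁ refl = h , inj₂ refl
... | h , inj₂ refl = suc h , inj₁ refl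

odd≢even : ∀ i j → suc (i * 2) ≢ j * 2
odd≢even (suc i) (suc j) eq = odd≢even i j (suc-injective (suc-injective eq))

^-double : ∀ m h → m ^ (h * 2) ≡ m ^ h * m ^ h
^-double m h = begin
  m ^ (h * 2)        ≡⟨ ^-*-assoc m h 2 ⟨
  m ^ h * (m ^ h * 1) ≡⟨ cong (m ^ h *_) (*-identityʳ (m ^ h)) ⟩
  m ^ h * m ^ h      ∎
  where open ≡-Reasoning

^-square : ∀ m h → m ^ (h * 2) ≡ (m * m) ^ h
^-square m zero    = refl
^-square m (suc h) = trans (sym (*-assoc m m (m ^ (h * 2)))) (cong (m * m *_) (^-square m h))

^-distribʳ-* : ∀ m n k → (m * n) ^ k ≡ m ^ k * n ^ k
^-distribʳ-* m n zero    = refl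
^-distribʳ-* m n (suc k) = trans (cong (m * n *_) (^-distribʳ-* m n k)) (interchange m n (m ^ k) (n ^ k))
  where
  interchange : ∀ m n a b → m * n * (a * b) ≡ m * a * (n * b)
  interchange = solve-∀

square-injective : ∀ {m n} → m * m ≡ n * n → m ≡ n
square-injective {m} {n} eq with <-cmp m n
... | tri< m<n _ _ = contradiction eq (<⇒≢ (*-mono-< m<n m<n))
... | tri≈ _ m≡n _ = m≡n
... | tri> _ _ n<m = contradiction (sym eq) (<⇒≢ (*-mono-< n<m n<m))

square-cancel-< : ∀ {m n} → m * m < n * n → m < n
square-cancel-< m²<n² = ≰⇒> λ n≤m → <⇒≱ m²<n² (*-mono-≤ n≤m n≤m)

-- Residues modulo 8

-- Reduces a claim about residues to the eight elements of `Fin 8`, where it is decided by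
-- evaluation.
%8-elim : (P : ℕ → Set) → (∀ (i : Fin 8) → P (toℕ i)) → ∀ n → P (n % 8)
%8-elim P f n = subst P (toℕ-fromℕ< (m%n<n n 8)) (f (fromℕ< (m%n<n n 8)))

%8-odd : ∀ n → n % 8 % 2 ≡ n % 2
%8-odd n = m∣n⇒o%n%m≡o%m 2 8 n (divides 4 refl)

odd-square%8 : ∀ n → n % 2 ≡ 1 → (n * n) % 8 ≡ 1
odd-square%8 n odd = trans (%-distribˡ-* n n 8)
  (%8-elim (λ r → r % 2 ≡ 1 → (r * r) % 8 ≡ 1)
    (from-yes (all? λ (i : Fin 8) → (toℕ i % 2 ≟ 1) →-dec (toℕ i * toℕ i) % 8 ≟ 1)) n
    (trans (%8-odd n) odd))

%8-sub-2 : ∀ s → (2 + s) % 8 ≡ 1 → s % 8 ≡ 7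
%8-sub-2 s eq = %8-elim (λ r → (2 + r) % 8 ≡ 1 → r ≡ 7)
  (from-yes (all? λ (i : Fin 8) → ((2 + toℕ i) % 8 ≟ 1) →-dec toℕ i ≟ 7)) s
  (trans (sym (%-distribˡ-+ 2 s 8)) eq)

%8-factorʳ-odd : ∀ e n → (e * n) % 8 ≡ 7 → e % 2 ≡ 1
%8-factorʳ-odd e n eq = trans (sym (%8-odd e))
  (%8-elim (λ a → (a * (n % 8)) % 8 ≡ 7 → a % 2 ≡ 1)
    (λ i → %8-elim (λ b → (toℕ i * b) % 8 ≡ 7 → toℕ i % 2 ≡ 1)
      (from-yes (all? λ (i : Fin 8) → all? λ (j : Fin 8) →
        ((toℕ i * toℕ j) % 8 ≟ 7) →-dec toℕ i % 2 ≟ 1) i) n) e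
    (trans (sym (%-distribˡ-* e n 8)) eq))

%8-cofactor : ∀ e n → (e * n) % 8 ≡ 7 → e % 8 ≡ 1 ⊎ e % 8 ≡ 7 → n % 8 ≡ 1 ⊎ n % 8 ≡ 7
%8-cofactor e n eq =
  %8-elim (λ a → (a * (n % 8)) % 8 ≡ 7 → a ≡ 1 ⊎ a ≡ 7 → n % 8 ≡ 1 ⊎ n % 8 ≡ 7)
    (λ i → %8-elim (λ b → (toℕ i * b) % 8 ≡ 7 → toℕ i ≡ 1 ⊎ toℕ i ≡ 7 → b ≡ 1 ⊎ b ≡ 7)
      (from-yes (all? λ (i : Fin 8) → all? λ (j : Fin 8) →
        ((toℕ i * toℕ j) % 8 ≟ 7) →-dec ((toℕ i ≟ 1 ⊎-dec toℕ i ≟ 7) →-dec (toℕ j ≟ 1 ⊎-dec toℕ j ≟ 7))) i) n) e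
    (trans (sym (%-distribˡ-* e n 8)) eq)

-- Moduli of which 2 is a quadratic residue

-- Both r and N - r are square roots of 2 modulo N if one of them is. The odd one is wanted because
-- its square minus 2 is 7 modulo 8.
odd-or-complement-odd : ∀ N r → N % 2 ≡ 1 → r ≤ N → r % 2 ≡ 1 ⊎ (N ∸ r) % 2 ≡ 1
odd-or-complement-odd N r N-odd r≤N with parity r
... | h , inj₂ refl = inj₁ (odd% h)
  where
  odd% : ∀ h → suc (h * 2) % 2 ≡ 1
  odd% zero    = refl
  odd% (suc h) = odd% h
... | h , inj₁ refl = inj₂ (trans (sym (drop h (N ∸ h * 2))) (trans (cong (_% 2) (m+[n∸m]≡n r≤N)) N-odd))
  where
  drop : ∀ h d → (h * 2 + d) % 2 ≡ d % 2
  drop zero    d = refl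
  drop (suc h) d = drop h d

-- Descent on N: an odd r ≤ N with r² ≡ 2 (mod N) has r² - 2 = e N with e < N, and e N ≡ 7 (mod 8).
√2-mod-odd : ∀ N → N % 2 ≡ 1 → ∀ t → ℤ.+ N ℤ.∣ t ℤ.* t ℤ.- ℤ.+ 2 → N % 8 ≡ 1 ⊎ N % 8 ≡ 7
√2-mod-odd = <-rec (λ N → N % 2 ≡ 1 → ∀ t → ℤ.+ N ℤ.∣ t ℤ.* t ℤ.- ℤ.+ 2 → N % 8 ≡ 1 ⊎ N % 8 ≡ 7) step
  where
  SquareMinus2 : ℤ.ℤ → ℤ.ℤ
  SquareMinus2 t = t ℤ.* t ℤ.- ℤ.+ 2

  step : ∀ N → (∀ {e} → e < N → e % 2 ≡ 1 → ∀ t → ℤ.+ e ℤ.∣ SquareMinus2 t → e % 8 ≡ 1 ⊎ e % 8 ≡ 7)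
       → N % 2 ≡ 1 → ∀ t → ℤ.+ N ℤ.∣ SquareMinus2 t → N % 8 ≡ 1 ⊎ N % 8 ≡ 7
  step N@(suc _) rec N-odd t N∣ =
    [ (λ odd → from-odd r r≤N odd N∣r) , (λ odd → from-odd (N ∸ r) (m∸n≤m N r) odd N∣N-r) ]′
      (odd-or-complement-odd N r N-odd r≤N)
    where
    r = t ℤ.%ℕ N
    j = t ℤ./ℕ N
    r≤N : r ≤ N
    r≤N = <⇒≤ (ℤ.n%ℕd<d t N)

    N∣r : ℤ.+ N ℤ.∣ SquareMinus2 (ℤ.+ r)
    N∣r = ℤ.∣m+n∣n⇒∣m {m = SquareMinus2 (ℤ.+ r)}
      (subst (ℤ.+ N ℤ.∣_) (trans (cong SquareMinus2 (ℤ.a≡a%ℕn+[a/ℕn]*n t N)) (expand (ℤ.+ r) j (ℤ.+ N))) N∣)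
      (ℤ.divides (ℤ.+ 2 ℤ.* ℤ.+ r ℤ.* j ℤ.+ j ℤ.* j ℤ.* ℤ.+ N) refl)
      where
      expand : ∀ r j N → (r ℤ.+ j ℤ.* N) ℤ.* (r ℤ.+ j ℤ.* N) ℤ.- ℤ.+ 2
             ≡ (r ℤ.* r ℤ.- ℤ.+ 2) ℤ.+ (ℤ.+ 2 ℤ.* r ℤ.* j ℤ.+ j ℤ.* j ℤ.* N) ℤ.* N
      expand = ℤ-Solver.solve-∀

    N∣N-r : ℤ.+ N ℤ.∣ SquareMinus2 (ℤ.+ (N ∸ r))
    N∣N-r = subst (λ a → ℤ.+ N ℤ.∣ SquareMinus2 a) (trans (ℤ.m-n≡m⊖n N r) (ℤ.⊖-≥ r≤N))
      (subst (ℤ.+ N ℤ.∣_) (sym (expand (ℤ.+ N) (ℤ.+ r)))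
        (ℤ.∣m∣n⇒∣m+n N∣r (ℤ.divides (ℤ.+ N ℤ.- ℤ.+ 2 ℤ.* ℤ.+ r) refl)))
      where
      expand : ∀ N r → (N ℤ.- r) ℤ.* (N ℤ.- r) ℤ.- ℤ.+ 2
             ≡ (r ℤ.* r ℤ.- ℤ.+ 2) ℤ.+ (N ℤ.- ℤ.+ 2 ℤ.* r) ℤ.* N
      expand = ℤ-Solver.solve-∀

    from-odd : ∀ r → r ≤ N → r % 2 ≡ 1 → ℤ.+ N ℤ.∣ SquareMinus2 (ℤ.+ r) → N % 8 ≡ 1 ⊎ N % 8 ≡ 7
    from-odd 1 _ _ N∣-1 = inj₁ (cong (_% 8) (∣1⇒≡1 (ℤ.∣⇒∣ᵤ N∣-1)))
    from-odd r@(suc (suc r′)) r≤N r-odd N∣ = from-quotient (ℤ.∣⇒∣ᵤ (subst (ℤ.+ N ℤ.∣_) r²-2≡ N∣))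
      where
      -- This is r² - 2 for r = 2 + r′, written without truncated subtraction.
      s = r′ * r′ + 4 * r′ + 2
      2+s≡r² : 2 + s ≡ r * r
      2+s≡r² = expand r′
        where
        expand : ∀ x → 2 + (x * x + 4 * x + 2) ≡ (2 + x) * (2 + x)
        expand = solve-∀
      r²-2≡ : SquareMinus2 (ℤ.+ r) ≡ ℤ.+ s
      r²-2≡ = trans (cong (ℤ._- ℤ.+ 2) (trans (sym (ℤ.pos-* r r)) (cong ℤ.+_ (sym 2+s≡r²)))) (ℤ.⊖-≥ {2 + s} {2} (s≤s (s≤s z≤n)))
      s%8 : s % 8 ≡ 7
      s%8 = %8-sub-2 s (trans (cong (_% 8) 2+s≡r²) (odd-square%8 r r-odd))
      from-quotient : N ∣ s → N % 8 ≡ 1 ⊎ N % 8 ≡ 7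
      from-quotient (divides e s≡) = %8-cofactor e N eN%8 (rec e<N (%8-factorʳ-odd e N eN%8) (ℤ.+ r) e∣)
        where
        eN%8 : (e * N) % 8 ≡ 7
        eN%8 = trans (cong (_% 8) (sym s≡)) s%8
        e<N : e < N
        e<N = *-cancelʳ-< N e N (begin-strict
          e * N   ≡⟨ s≡ ⟨
          s       <⟨ m<n+m s {2} (s≤s z≤n) ⟩
          2 + s   ≡⟨ 2+s≡r² ⟩
          r * r   ≤⟨ *-mono-≤ r≤N r≤N ⟩
          N * N   ∎)
          where open ≤-Reasoning
        e∣ : ℤ.+ e ℤ.∣ SquareMinus2 (ℤ.+ r)
        e∣ = subst (ℤ.+ e ℤ.∣_) (sym r²-2≡) (ℤ.∣ᵤ⇒∣ (divides N (trans s≡ (*-comm e N))))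

inverse-mod : ∀ {a N} → Coprime a N → ∃₂ λ u k → u ℤ.* ℤ.+ a ≡ ℤ.1ℤ ℤ.+ k ℤ.* ℤ.+ N
inverse-mod {a} {N} coprime with coprime-Bézout coprime
... | Bézout.+- x y eq = ℤ.+ x , ℤ.+ y , (begin
    ℤ.+ x ℤ.* ℤ.+ a            ≡⟨ ℤ.pos-* x a ⟨
    ℤ.+ (x * a)                ≡⟨ cong ℤ.+_ eq ⟨
    ℤ.1ℤ ℤ.+ ℤ.+ (y * N)       ≡⟨ cong (ℤ._+_ ℤ.1ℤ) (ℤ.pos-* y N) ⟩
    ℤ.1ℤ ℤ.+ ℤ.+ y ℤ.* ℤ.+ N   ∎)
  where open ≡-Reasoning
... | Bézout.-+ x y eq = ℤ.- ℤ.+ x , ℤ.- ℤ.+ y , (begin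
    ℤ.- ℤ.+ x ℤ.* ℤ.+ a                              ≡⟨ add-sub (ℤ.+ x) (ℤ.+ a) ⟩
    ℤ.1ℤ ℤ.- (ℤ.1ℤ ℤ.+ ℤ.+ x ℤ.* ℤ.+ a)              ≡⟨ cong (λ b → ℤ.1ℤ ℤ.- (ℤ.1ℤ ℤ.+ b)) (ℤ.pos-* x a) ⟨
    ℤ.1ℤ ℤ.- ℤ.+ (1 + x * a)                         ≡⟨ cong (λ b → ℤ.1ℤ ℤ.- ℤ.+ b) eq ⟩
    ℤ.1ℤ ℤ.- ℤ.+ (y * N)                             ≡⟨ cong (λ b → ℤ.1ℤ ℤ.- b) (ℤ.pos-* y N) ⟩
    ℤ.1ℤ ℤ.- ℤ.+ y ℤ.* ℤ.+ N                         ≡⟨ move-neg (ℤ.+ y) (ℤ.+ N) ⟩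
    ℤ.1ℤ ℤ.+ ℤ.- ℤ.+ y ℤ.* ℤ.+ N                     ∎)
  where
  open ≡-Reasoning
  add-sub : ∀ x a → ℤ.- x ℤ.* a ≡ ℤ.1ℤ ℤ.- (ℤ.1ℤ ℤ.+ x ℤ.* a)
  add-sub = ℤ-Solver.solve-∀
  move-neg : ∀ y N → ℤ.1ℤ ℤ.- y ℤ.* N ≡ ℤ.1ℤ ℤ.+ ℤ.- y ℤ.* N
  move-neg = ℤ-Solver.solve-∀

-- If u inverts B modulo N, then A u is a square root of 2 modulo N.
2-residue : ∀ N A B e → N % 2 ≡ 1 → Coprime B N → 2 * (B * B) ≡ A * A + e * N → N % 8 ≡ 1 ⊎ N % 8 ≡ 7
2-residue N A B e N-odd coprime eq = from-inverse (inverse-mod coprime)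
  where
  open ≡-Reasoning
  regroup : ∀ A u E → A ℤ.* u ℤ.* (A ℤ.* u) ℤ.- ℤ.+ 2 ≡ (A ℤ.* A ℤ.+ E) ℤ.* (u ℤ.* u) ℤ.- E ℤ.* (u ℤ.* u) ℤ.- ℤ.+ 2
  regroup = ℤ-Solver.solve-∀
  regroup′ : ∀ B u E → ℤ.+ 2 ℤ.* (B ℤ.* B) ℤ.* (u ℤ.* u) ℤ.- E ℤ.- ℤ.+ 2
           ≡ ℤ.+ 2 ℤ.* (u ℤ.* B ℤ.* (u ℤ.* B)) ℤ.- E ℤ.- ℤ.+ 2
  regroup′ = ℤ-Solver.solve-∀
  collect : ∀ N k e u →
    ℤ.+ 2 ℤ.* ((ℤ.1ℤ ℤ.+ k ℤ.* N) ℤ.* (ℤ.1ℤ ℤ.+ k ℤ.* N)) ℤ.- e ℤ.* N ℤ.* (u ℤ.* u) ℤ.- ℤ.+ 2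
    ≡ (ℤ.+ 4 ℤ.* k ℤ.+ ℤ.+ 2 ℤ.* k ℤ.* k ℤ.* N ℤ.- e ℤ.* u ℤ.* u) ℤ.* N
  collect = ℤ-Solver.solve-∀
  eqℤ : ℤ.+ 2 ℤ.* (ℤ.+ B ℤ.* ℤ.+ B) ≡ ℤ.+ A ℤ.* ℤ.+ A ℤ.+ ℤ.+ e ℤ.* ℤ.+ N
  eqℤ = begin
    ℤ.+ 2 ℤ.* (ℤ.+ B ℤ.* ℤ.+ B)             ≡⟨ cong (ℤ._*_ (ℤ.+ 2)) (ℤ.pos-* B B) ⟨
    ℤ.+ 2 ℤ.* ℤ.+ (B * B)                   ≡⟨ ℤ.pos-* 2 (B * B) ⟨
    ℤ.+ (2 * (B * B))                       ≡⟨ cong ℤ.+_ eq ⟩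
    ℤ.+ (A * A) ℤ.+ ℤ.+ (e * N)             ≡⟨ cong₂ ℤ._+_ (ℤ.pos-* A A) (ℤ.pos-* e N) ⟩
    ℤ.+ A ℤ.* ℤ.+ A ℤ.+ ℤ.+ e ℤ.* ℤ.+ N     ∎
  from-inverse : (∃₂ λ u k → u ℤ.* ℤ.+ B ≡ ℤ.1ℤ ℤ.+ k ℤ.* ℤ.+ N) → N % 8 ≡ 1 ⊎ N % 8 ≡ 7
  from-inverse (u , k , uB≡) = √2-mod-odd N N-odd (ℤ.+ A ℤ.* u)
    (ℤ.divides (ℤ.+ 4 ℤ.* k ℤ.+ ℤ.+ 2 ℤ.* k ℤ.* k ℤ.* ℤ.+ N ℤ.- ℤ.+ e ℤ.* u ℤ.* u) (begin
    ℤ.+ A ℤ.* u ℤ.* (ℤ.+ A ℤ.* u) ℤ.- ℤ.+ 2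
      ≡⟨ regroup (ℤ.+ A) u (ℤ.+ e ℤ.* ℤ.+ N) ⟩
    (ℤ.+ A ℤ.* ℤ.+ A ℤ.+ ℤ.+ e ℤ.* ℤ.+ N) ℤ.* (u ℤ.* u) ℤ.- ℤ.+ e ℤ.* ℤ.+ N ℤ.* (u ℤ.* u) ℤ.- ℤ.+ 2
      ≡⟨ cong (λ a → a ℤ.* (u ℤ.* u) ℤ.- ℤ.+ e ℤ.* ℤ.+ N ℤ.* (u ℤ.* u) ℤ.- ℤ.+ 2) eqℤ ⟨
    ℤ.+ 2 ℤ.* (ℤ.+ B ℤ.* ℤ.+ B) ℤ.* (u ℤ.* u) ℤ.- ℤ.+ e ℤ.* ℤ.+ N ℤ.* (u ℤ.* u) ℤ.- ℤ.+ 2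
      ≡⟨ regroup′ (ℤ.+ B) u (ℤ.+ e ℤ.* ℤ.+ N ℤ.* (u ℤ.* u)) ⟩
    ℤ.+ 2 ℤ.* (u ℤ.* ℤ.+ B ℤ.* (u ℤ.* ℤ.+ B)) ℤ.- ℤ.+ e ℤ.* ℤ.+ N ℤ.* (u ℤ.* u) ℤ.- ℤ.+ 2
      ≡⟨ cong (λ a → ℤ.+ 2 ℤ.* (a ℤ.* a) ℤ.- ℤ.+ e ℤ.* ℤ.+ N ℤ.* (u ℤ.* u) ℤ.- ℤ.+ 2) uB≡ ⟩
    ℤ.+ 2 ℤ.* ((ℤ.1ℤ ℤ.+ k ℤ.* ℤ.+ N) ℤ.* (ℤ.1ℤ ℤ.+ k ℤ.* ℤ.+ N)) ℤ.- ℤ.+ e ℤ.* ℤ.+ N ℤ.* (u ℤ.* u) ℤ.- ℤ.+ 2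
      ≡⟨ collect (ℤ.+ N) k (ℤ.+ e) u ⟩
    (ℤ.+ 4 ℤ.* k ℤ.+ ℤ.+ 2 ℤ.* k ℤ.* k ℤ.* ℤ.+ N ℤ.- ℤ.+ e ℤ.* u ℤ.* u) ℤ.* ℤ.+ N ∎))

-- Coprimality and prime divisors

coprime-* : ∀ {a b c} → Coprime a c → Coprime b c → Coprime (a * b) c
coprime-* a⊥c b⊥c (d∣ab , d∣c) =
  b⊥c (coprime-divisor (λ (i∣d , i∣a) → a⊥c (i∣a , ∣-trans i∣d d∣c)) d∣ab , d∣c)

coprime-^ : ∀ {a c} k → Coprime a c → Coprime (a ^ k) c
coprime-^ zero    a⊥c (d∣1 , _) = ∣1⇒≡1 d∣1
coprime-^ (suc k) a⊥c = coprime-* a⊥c (coprime-^ k a⊥c)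

coprime-^-^ : ∀ {a b} j k → Coprime a b → Coprime (a ^ j) (b ^ k)
coprime-^-^ j k a⊥b = coprime-sym (coprime-^ k (coprime-sym (coprime-^ j a⊥b)))

prime≢1 : ∀ {p} → Prime p → p ≢ 1
prime≢1 {p} p-prime = nonTrivial⇒≢1 {p} {{prime⇒nonTrivial p-prime}}

prime∧∤⇒coprime : ∀ {p n} → Prime p → ¬ p ∣ n → Coprime p n
prime∧∤⇒coprime p-prime p∤n (d∣p , d∣n) with prime⇒irreducible p-prime d∣p
... | inj₁ d≡1  = d≡1
... | inj₂ refl = contradiction d∣n p∤n

coprime-2-odd : ∀ {n} → n % 2 ≡ 1 → Coprime 2 n
coprime-2-odd {n} odd = prime∧∤⇒coprime prime[2] λ 2∣n → 0≢1+n (trans (sym (n∣m⇒m%n≡0 n 2 2∣n)) odd)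

prime-∣-^ : ∀ {p} a k → Prime p → p ∣ a ^ k → p ∣ a
prime-∣-^ a zero    p-prime p∣1 = contradiction (∣1⇒≡1 p∣1) (prime≢1 p-prime)
prime-∣-^ a (suc k) p-prime p∣ = [ (λ p∣a → p∣a) , prime-∣-^ a k p-prime ]′ (euclidsLemma a (a ^ k) p-prime p∣)

∃-prime-divisor : ∀ n → n ≢ 1 → ∃ λ p → Prime p × p ∣ n
∃-prime-divisor zero    _   = 2 , prime[2] , 2 ∣0
∃-prime-divisor n@(suc _) n≢1 with factorise n
... | record { factors = [] ; isFactorisation = n≡1 } = contradiction n≡1 n≢1
... | record { factors = p ∷ ps ; isFactorisation = n≡ ; factorsPrime = p-prime ∷ _ } =
  p , p-prime , subst (p ∣_) (sym n≡) (m∣m*n _)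

∣prime^⇒prime∣ : ∀ {p d} k → Prime p → d ∣ p ^ k → d ≢ 1 → p ∣ d
∣prime^⇒prime∣ {p} {d} k p-prime d∣ d≢1 with ∃-prime-divisor d d≢1
... | r , r-prime , r∣d with prime⇒irreducible p-prime (prime-∣-^ p k r-prime (∣-trans r∣d d∣))
... | inj₁ r≡1  = contradiction r≡1 (prime≢1 r-prime)
... | inj₂ refl = r∣d

prime^∣coprime-product : ∀ {p a b} k → Prime p → Coprime a b → p ^ k ∣ a * b → p ^ k ∣ a ⊎ p ^ k ∣ b
prime^∣coprime-product {p} {a} {b} zero p-prime a⊥b _ = inj₁ (1∣ a)
prime^∣coprime-product {p} {a} {b} k@(suc k′) p-prime a⊥b p^k∣ab
  with euclidsLemma a b p-prime (∣-trans (m∣m*n (p ^ k′)) p^k∣ab)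
... | inj₁ p∣a = inj₁ (coprime-divisor {n = b}
        (coprime-^ k (prime∧∤⇒coprime p-prime λ p∣b → prime≢1 p-prime (a⊥b (p∣a , p∣b))))
        (subst (p ^ k ∣_) (*-comm a b) p^k∣ab))
... | inj₂ p∣b = inj₂ (coprime-divisor {n = a}
        (coprime-^ k (prime∧∤⇒coprime p-prime λ p∣a → prime≢1 p-prime (a⊥b (p∣a , p∣b))))
        p^k∣ab)

module _ {P Q : ℕ} .{{_ : NonZero (P * Q)}} where

  product-split-apart : ∀ {A B} → A * B ≡ P * Q → P ∣ A → Q ∣ B → A + B ≡ P + Q
  product-split-apart AB≡PQ (divides a refl) (divides b refl) =
    cong₂ _+_ (trans (cong (_* P) (m*n≡1⇒m≡1 a b ab≡1)) (*-identityˡ P))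
              (trans (cong (_* Q) (m*n≡1⇒n≡1 a b ab≡1)) (*-identityˡ Q))
    where
    interchange : ∀ a P b Q → a * P * (b * Q) ≡ a * b * (P * Q)
    interchange = solve-∀
    ab≡1 : a * b ≡ 1
    ab≡1 = *-cancelʳ-≡ (a * b) 1 (P * Q) (trans (sym (interchange a P b Q)) (trans AB≡PQ (sym (*-identityˡ (P * Q)))))

  product-split-together : ∀ {A B} → Coprime P Q → A * B ≡ P * Q → P ∣ A → Q ∣ A → A + B ≡ P * Q + 1
  product-split-together {A} {B} P⊥Q AB≡PQ (divides a refl) Q∣aP
    with coprime-divisor {n = P} (coprime-sym P⊥Q) (subst (Q ∣_) (*-comm a P) Q∣aP)
  ... | divides a′ refl = cong₂ _+_ (trans (swap a′ Q P) (trans (cong (_* (P * Q)) (m*n≡1⇒m≡1 a′ B a′B≡1)) (*-identityˡ (P * Q))))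
                                    (m*n≡1⇒n≡1 a′ B a′B≡1)
    where
    swap : ∀ a Q P → a * Q * P ≡ a * (P * Q)
    swap = solve-∀
    regroup : ∀ a Q P B → a * Q * P * B ≡ a * B * (P * Q)
    regroup = solve-∀
    a′B≡1 : a′ * B ≡ 1
    a′B≡1 = *-cancelʳ-≡ (a′ * B) 1 (P * Q) (trans (sym (regroup a′ Q P B)) (trans AB≡PQ (sym (*-identityˡ (P * Q)))))

-- Each of pᵏ and qᵏ lies wholly in A or wholly in B. Recording only A + B makes the outcome
-- symmetric in the two factors, and for the factors cᵏ ± x the sum is the known quantity.
coprime-product-split : ∀ {p q} k {A B} → Prime p → Prime q → Coprime p q → Coprime A B
                      → A * B ≡ p ^ k * q ^ k → A + B ≡ p ^ k + q ^ k ⊎ A + B ≡ p ^ k * q ^ k + 1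
coprime-product-split {p} {q} k {A} {B} p-prime q-prime p⊥q A⊥B AB≡ = cases
  (prime^∣coprime-product k p-prime A⊥B (subst (p ^ k ∣_) (sym AB≡) (m∣m*n (q ^ k))))
  (prime^∣coprime-product k q-prime A⊥B (subst (q ^ k ∣_) (sym AB≡) (n∣m*n (p ^ k))))
  where
  P = p ^ k
  Q = q ^ k
  instance
    PQ≢0 : NonZero (P * Q)
    PQ≢0 = m*n≢0 P Q {{m^n≢0 p k {{prime⇒nonZero p-prime}}}} {{m^n≢0 q k {{prime⇒nonZero q-prime}}}}
  BA≡ : B * A ≡ P * Q
  BA≡ = trans (*-comm B A) AB≡
  P⊥Q : Coprime P Q
  P⊥Q = coprime-^-^ k k p⊥q
  cases : P ∣ A ⊎ P ∣ B → Q ∣ A ⊎ Q ∣ B → A + B ≡ P + Q ⊎ A + B ≡ P * Q + 1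
  cases (inj₁ P∣A) (inj₂ Q∣B) = inj₁ (product-split-apart AB≡ P∣A Q∣B)
  cases (inj₂ P∣B) (inj₁ Q∣A) = inj₁ (trans (+-comm A B) (product-split-apart BA≡ P∣B Q∣A))
  cases (inj₁ P∣A) (inj₁ Q∣A) = inj₂ (product-split-together P⊥Q AB≡ P∣A Q∣A)
  cases (inj₂ P∣B) (inj₂ Q∣B) = inj₂ (trans (+-comm A B) (product-split-together P⊥Q BA≡ P∣B Q∣B))

-- The equation Pˡ + Qˡ = 2 cᵏ

-- The recurrence of the power sums of a and b, with its negative term moved across. Modulo a + b it
-- links the exponents 2 + n and n, so odd exponents descend to a + b and even ones to the value 2
-- at exponent 0.
power-sum-step : ∀ a b n → (a + b) * (a ^ (1 + n) + b ^ (1 + n)) ≡ a ^ (2 + n) + b ^ (2 + n) + a * b * (a ^ n + b ^ n)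
power-sum-step a b n = expand a b (a ^ n) (b ^ n)
  where
  expand : ∀ a b x y → (a + b) * (a * x + b * y) ≡ a * (a * x) + b * (b * y) + a * b * (x + y)
  expand = solve-∀

+∣^+^ : ∀ a b h → a + b ∣ a ^ suc (h * 2) + b ^ suc (h * 2)
+∣^+^ a b zero    = ∣-reflexive (sym (cong₂ _+_ (*-identityʳ a) (*-identityʳ b)))
+∣^+^ a b (suc h) = ∣m+n∣n⇒∣m′
  (subst (a + b ∣_) (power-sum-step a b (suc (h * 2))) (m∣m*n _))
  (∣n⇒∣m*n (a * b) (+∣^+^ a b h))
  where
  ∣m+n∣n⇒∣m′ : ∀ {d m n} → d ∣ m + n → d ∣ n → d ∣ m
  ∣m+n∣n⇒∣m′ {d} {m} {n} d∣m+n d∣n = ∣m+n∣m⇒∣n (subst (d ∣_) (+-comm m n) d∣m+n) d∣n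

-- Modulo c the recurrence only multiplies by -a b, which is invertible, so divisibility by c passes
-- down to exponent 0.
∣even-power-sum⇒∣2 : ∀ {c} a b h → c ∣ a + b → Coprime c (a * b) → c ∣ a ^ (h * 2) + b ^ (h * 2) → c ∣ 2
∣even-power-sum⇒∣2 a b zero    _ _ c∣2 = c∣2
∣even-power-sum⇒∣2 {c} a b (suc h) c∣a+b c⊥ab c∣ = ∣even-power-sum⇒∣2 a b h c∣a+b c⊥ab
  (coprime-divisor c⊥ab (∣m+n∣m⇒∣n (subst (c ∣_) (power-sum-step a b (h * 2)) (∣m⇒∣m*n _ c∣a+b)) c∣))

3+n<x^2+n : ∀ {x} n → 2 ≤ x → 3 + n < x ^ (2 + n)
3+n<x^2+n zero 2≤x = ^-monoˡ-≤ 2 2≤x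
3+n<x^2+n {x} (suc n) 2≤x = begin-strict
  4 + n               <⟨ m<m*n (4 + n) 2 (s≤s (s≤s z≤n)) ⟩
  (4 + n) * 2         ≡⟨ *-comm (4 + n) 2 ⟩
  2 * (4 + n)         ≤⟨ *-mono-≤ 2≤x (3+n<x^2+n n 2≤x) ⟩
  x * x ^ (2 + n)     ∎
  where open ≤-Reasoning

r*x<x^r : ∀ {x} n → 2 ≤ x → (3 + n) * x < x ^ (3 + n)
r*x<x^r {x} n 2≤x = subst ((3 + n) * x <_) (*-comm (x ^ (2 + n)) x)
  (*-monoˡ-< x {{>-nonZero (<⇒≤ 2≤x)}} (3+n<x^2+n n 2≤x))

-- Only a prime factor r of the exponent can divide σ = (Pʳ + Qʳ) / (P + Q), and it does so at most
-- once; but σ > r.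
no-prime-power-sum : ∀ {c P Q} h k → OddCofactor P Q (suc h) → Prime (3 + h * 2) → P + Q ≡ 2 * c → Coprime P c → 2 ≤ P → 2 ≤ Q
                   → ¬ P ^ (3 + h * 2) + Q ^ (3 + h * 2) ∣ 2 * c ^ k
no-prime-power-sum {c} {P} {Q} h k cofactor r-prime P+Q≡2c P⊥c 2≤P 2≤Q sum∣ = σ≢r (only-r σ≢1 ∣-refl)
  where
  r : ℕ
  r = 3 + h * 2
  open OddCofactor cofactor using (σ; factors; common; square)
  instance
    P+Q≢0 : NonZero (P + Q)
    P+Q≢0 = >-nonZero (≤-trans (<⇒≤ 2≤P) (m≤m+n P Q))

  r<σ : r < σ
  r<σ = *-cancelˡ-< (P + Q) r σ (begin-strict
    (P + Q) * r          ≡⟨ *-comm (P + Q) r ⟩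
    r * (P + Q)          ≡⟨ *-distribˡ-+ r P Q ⟩
    r * P + r * Q        <⟨ +-mono-< (r*x<x^r (h * 2) 2≤P) (r*x<x^r (h * 2) 2≤Q) ⟩
    P ^ r + Q ^ r        ≡⟨ factors ⟩
    (P + Q) * σ          ∎)
    where open ≤-Reasoning

  σ≢1 : σ ≢ 1
  σ≢1 σ≡1 = <⇒≱ r<σ (≤-trans (≤-reflexive σ≡1) (s≤s z≤n))

  σ∣c^k : σ ∣ c ^ k
  σ∣c^k = m*n∣⇒n∣ c σ (*-cancelˡ-∣ 2
    (subst (_∣ 2 * c ^ k) (trans factors (trans (cong (_* σ) P+Q≡2c) (*-assoc 2 c σ))) sum∣))

  c∣P+Q : c ∣ P + Q
  c∣P+Q = divides 2 P+Q≡2c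

  prime∤P : ∀ {s} → Prime s → s ∣ c → ¬ s ∣ P
  prime∤P s-prime s∣c s∣P = prime≢1 s-prime (P⊥c (s∣P , s∣c))

  prime∣c : ∀ {s} → Prime s → s ∣ σ → s ∣ c
  prime∣c s-prime s∣σ = prime-∣-^ c k s-prime (∣-trans s∣σ σ∣c^k)

  prime∣σ⇒≡r : ∀ {s} → Prime s → s ∣ σ → s ≡ r
  prime∣σ⇒≡r {s} s-prime s∣σ
    with euclidsLemma r (P ^ (suc h * 2)) s-prime (common s (∣-trans (prime∣c s-prime s∣σ) c∣P+Q) s∣σ)
  ... | inj₂ s∣P^ = contradiction (prime-∣-^ P (suc h * 2) s-prime s∣P^) (prime∤P s-prime (prime∣c s-prime s∣σ))
  ... | inj₁ s∣r with prime⇒irreducible r-prime s∣r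
  ...   | inj₁ s≡1 = contradiction s≡1 (prime≢1 s-prime)
  ...   | inj₂ s≡r = s≡r

  r∣ : ∀ {d} → d ≢ 1 → d ∣ σ → r ∣ d
  r∣ {d} d≢1 d∣σ with ∃-prime-divisor d d≢1
  ... | s , s-prime , s∣d = subst (_∣ d) (prime∣σ⇒≡r s-prime (∣-trans s∣d d∣σ)) s∣d

  r∣c : r ∣ c
  r∣c = prime∣c r-prime (r∣ σ≢1 ∣-refl)

  r²∤σ : ¬ r * r ∣ σ
  -- By `square`, r² would divide r P^(r-1), hence r would divide P; but r divides c, which is
  -- coprime to P.
  r²∤σ r²∣σ = prime∤P r-prime r∣c (prime-∣-^ P (suc h * 2) r-prime
    (*-cancelˡ-∣ r (square (∣-trans r∣c c∣P+Q) r²∣σ)))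

  only-r : ∀ {d} → d ≢ 1 → d ∣ σ → d ≡ r
  only-r {d} d≢1 d∣σ with r∣ d≢1 d∣σ
  ... | divides a refl with a ≟ 1
  ...   | yes refl = *-identityˡ r
  ...   | no  a≢1 = contradiction (∣-trans (*-monoˡ-∣ r (r∣ a≢1 (m*n∣⇒m∣ a r d∣σ))) d∣σ) r²∤σ

  σ≢r : σ ≢ r
  σ≢r σ≡r = <-irrefl (sym σ≡r) r<σ

odd-factor : ∀ {i} j d → d * i ≡ suc (j * 2) → ∃ λ h → i ≡ suc (h * 2)
odd-factor {i} j d di≡ with parity i
... | h , inj₂ i≡   = h , i≡
... | h , inj₁ refl = contradiction (trans (sym di≡) (sym (*-assoc d h 2))) (odd≢even j (d * h))

-- If r is a prime factor of the exponent, the complementary factor is odd too, so Pʳ + Qʳ divides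
-- the whole sum and the prime case applies.
no-odd-power-sum : ∀ {c P Q} j k → P + Q ≡ 2 * c → Coprime P c → 2 ≤ P → 2 ≤ Q
                 → P ^ (3 + j * 2) + Q ^ (3 + j * 2) ≢ 2 * c ^ k
no-odd-power-sum {c} {P} {Q} j k P+Q≡2c P⊥c 2≤P 2≤Q eq with ∃-prime-divisor (3 + j * 2) (λ ())
... | r , r-prime , divides a l≡
  with odd-factor (suc j) a (sym l≡) | odd-factor (suc j) r (trans (*-comm r a) (sym l≡))
... | zero  , refl | _ = prime≢1 r-prime refl
... | suc h , refl | i , refl = no-prime-power-sum h k (odd-cofactor P Q h) r-prime P+Q≡2c P⊥c 2≤P 2≤Q
  (subst (P ^ r + Q ^ r ∣_) (trans (cong₂ _+_ (power P) (power Q)) eq) (+∣^+^ (P ^ r) (Q ^ r) i))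
  where
  power : ∀ X → (X ^ r) ^ suc (i * 2) ≡ X ^ (3 + j * 2)
  power X = trans (^-*-assoc X r (suc (i * 2))) (cong (X ^_) (trans (*-comm r (suc (i * 2))) (sym l≡)))

-- The equation 1 + (p q)ʸ = 2 cᵏ

-- From w² = p² + (q - 1)(q + 1) follow w > p and, as p exceeds q + 1, also that p does not divide
-- w. So w divides a power of q, and being larger than q it is a multiple of q². Yet w ≥ p + 1 gives
-- q² - 1 = w² - p² ≥ 2w - 1, whence q² > w.
no-square+1 : ∀ {p q n} w l → Prime p → Prime q → 2 ≤ q → 0 < n → p ≡ q + 2 * n
            → w * w + 1 ≡ p * p + q * q → ¬ w ∣ (p * q) ^ l
no-square+1 {p} {suc q′} {suc n} w l p-prime q-prime (s≤s 1≤q′) _ p≡ w²+1≡ w∣ = contradict w p<w w²+1≡ q²≤w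
  where
  q = suc q′

  q<p : 1 + q < p
  q<p = begin-strict
    1 + q           <⟨ n<1+n (1 + q) ⟩
    2 + q           ≡⟨ +-comm 2 q ⟩
    q + 2           ≤⟨ +-monoʳ-≤ q (*-monoʳ-≤ 2 (s≤s z≤n)) ⟩
    q + 2 * suc n   ≡⟨ p≡ ⟨
    p               ∎
    where open ≤-Reasoning

  q²≡ : q * q ≡ 1 + q′ * (2 + q′)
  q²≡ = expand q′
    where
    expand : ∀ x → (1 + x) * (1 + x) ≡ 1 + x * (2 + x)
    expand = solve-∀

  w²≡ : w * w ≡ p * p + q′ * (2 + q′)
  w²≡ = suc-injective (begin
    1 + w * w                       ≡⟨ +-comm 1 (w * w) ⟩
    w * w + 1                       ≡⟨ w²+1≡ ⟩
    p * p + q * q                   ≡⟨ cong (p * p +_) q²≡ ⟩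
    p * p + (1 + q′ * (2 + q′))     ≡⟨ +-suc (p * p) _ ⟩
    1 + (p * p + q′ * (2 + q′))     ∎)
    where open ≡-Reasoning

  instance
    q′≢0 : NonZero q′
    q′≢0 = >-nonZero 1≤q′

  p<w : p < w
  p<w = square-cancel-< (subst (p * p <_) (sym w²≡) (m<m+n (p * p) (*-mono-≤ 1≤q′ (s≤s z≤n))))

  p∤w : ¬ p ∣ w
  p∤w p∣w with euclidsLemma q′ (2 + q′) p-prime (∣m+n∣m⇒∣n (subst (p ∣_) w²≡ (∣m⇒∣m*n w p∣w)) (m∣m*n p))
  ... | inj₁ p∣q′   = <⇒≱ (<-trans (n<1+n q′) (<-trans (n<1+n q) q<p)) (∣⇒≤ p∣q′)
  ... | inj₂ p∣2+q′ = <⇒≱ q<p (∣⇒≤ p∣2+q′)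

  w∣q^l : w ∣ q ^ l
  w∣q^l = coprime-divisor (coprime-sym (coprime-^ l (prime∧∤⇒coprime p-prime p∤w)))
            (subst (w ∣_) (^-distribʳ-* p q l) w∣)

  q<w : q < w
  q<w = <-trans (<-trans (n<1+n q) q<p) p<w

  q²∣w : q * q ∣ w
  q²∣w with ∣prime^⇒prime∣ l q-prime w∣q^l (λ w≡1 → <⇒≱ q<w (≤-trans (≤-reflexive w≡1) (s≤s z≤n)))
  ... | divides a w≡aq = subst (q * q ∣_) (sym w≡aq) (*-monoˡ-∣ q
          (∣prime^⇒prime∣ l q-prime (∣-trans (divides q (trans w≡aq (*-comm a q))) w∣q^l)
            (λ a≡1 → <-irrefl (sym (trans w≡aq (trans (cong (_* q) a≡1) (*-identityˡ q)))) q<w)))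

  q²≤w : q * q ≤ w
  q²≤w = ∣⇒≤ {{>-nonZero (≤-trans (s≤s z≤n) q<w)}} q²∣w

  contradict : ∀ w → p < w → w * w + 1 ≡ p * p + q * q → ¬ q * q ≤ w
  contradict (suc w′) (s≤s p≤w′) eq q²≤w = <-irrefl refl (begin-strict
    p * p + q * q                   ≤⟨ +-mono-≤ (*-mono-≤ p≤w′ p≤w′) q²≤w ⟩
    w′ * w′ + suc w′                <⟨ m<m+n (w′ * w′ + suc w′) (s≤s z≤n) ⟩
    w′ * w′ + suc w′ + suc w′       ≡⟨ expand w′ ⟩
    suc w′ * suc w′ + 1             ≡⟨ eq ⟩
    p * p + q * q                   ∎)
    where
    open ≤-Reasoning
    expand : ∀ x → x * x + (1 + x) + (1 + x) ≡ (1 + x) * (1 + x) + 1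
    expand = solve-∀

-- Residues modulo 8 of b, c and their powers

%8-odd-power : ∀ b l → (b * b) % 8 ≡ 1 → (b ^ suc (l * 2)) % 8 ≡ b % 8
%8-odd-power b zero    _   = cong (_% 8) (*-identityʳ b)
%8-odd-power b (suc l) eq = begin
  (b * (b * Z)) % 8                  ≡⟨ cong (_% 8) (*-assoc b b Z) ⟨
  (b * b * Z) % 8                    ≡⟨ %-distribˡ-* (b * b) Z 8 ⟩
  ((b * b) % 8 * (Z % 8)) % 8        ≡⟨ cong (λ a → (a * (Z % 8)) % 8) eq ⟩
  (1 * (Z % 8)) % 8                  ≡⟨ %-distribˡ-* 1 Z 8 ⟨
  (1 * Z) % 8                        ≡⟨ cong (_% 8) (*-identityˡ Z) ⟩
  Z % 8                              ≡⟨ %8-odd-power b l eq ⟩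
  b % 8                              ∎
  where
  open ≡-Reasoning
  Z = b ^ suc (l * 2)

%8-double-power : ∀ c k → c % 8 ≡ 5 → (2 * c ^ k) % 8 ≡ 2
%8-double-power c zero    _   = refl
%8-double-power c (suc k) c≡5 = begin
  (2 * (c * c ^ k)) % 8              ≡⟨ cong (_% 8) (swap c (c ^ k)) ⟩
  (c * (2 * c ^ k)) % 8              ≡⟨ %-distribˡ-* c (2 * c ^ k) 8 ⟩
  (c % 8 * ((2 * c ^ k) % 8)) % 8    ≡⟨ cong₂ (λ a b → (a * b) % 8) c≡5 (%8-double-power c k c≡5) ⟩
  2                                  ∎
  where
  open ≡-Reasoning
  swap : ∀ c z → 2 * (c * z) ≡ c * (2 * z)
  swap = solve-∀

-- Twice a square is 0 or 2 modulo 8.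
%8-from-sum : ∀ b c m → c % 8 ≡ 5 → c + b ≡ 2 * (m * m) → b % 8 ≡ 3 ⊎ b % 8 ≡ 5
%8-from-sum b c m c≡5 eq =
  %8-elim (λ a → (5 + a) % 8 ≡ (2 * (m % 8 * (m % 8))) % 8 → a ≡ 3 ⊎ a ≡ 5)
    (λ i → %8-elim (λ r → (5 + toℕ i) % 8 ≡ (2 * (r * r)) % 8 → toℕ i ≡ 3 ⊎ toℕ i ≡ 5)
      (from-yes (all? λ (i : Fin 8) → all? λ (j : Fin 8) →
        ((5 + toℕ i) % 8 ≟ (2 * (toℕ j * toℕ j)) % 8) →-dec (toℕ i ≟ 3 ⊎-dec toℕ i ≟ 5)) i) m) b
    (begin
      (5 + b % 8) % 8                  ≡⟨ cong (λ a → (a + b % 8) % 8) c≡5 ⟨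
      (c % 8 + b % 8) % 8              ≡⟨ %-distribˡ-+ c b 8 ⟨
      (c + b) % 8                      ≡⟨ cong (_% 8) eq ⟩
      (2 * (m * m)) % 8                ≡⟨ %-distribˡ-* 2 (m * m) 8 ⟩
      (2 * ((m * m) % 8)) % 8          ≡⟨ cong (λ a → (2 * a) % 8) (%-distribˡ-* m m 8) ⟩
      (2 * ((m % 8 * (m % 8)) % 8)) % 8 ≡⟨ %-distribˡ-* 2 (m % 8 * (m % 8)) 8 ⟨
      (2 * (m % 8 * (m % 8))) % 8      ∎)
  where open ≡-Reasoning

%8-3-or-5 : ∀ b → b % 8 ≡ 3 ⊎ b % 8 ≡ 5 → b % 2 ≡ 1 × (b * b) % 8 ≡ 1 × (1 + b) % 8 ≢ 2
                                        × ¬ (b % 8 ≡ 1 ⊎ b % 8 ≡ 7)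
%8-3-or-5 b b≡ = odd b≡ , odd-square%8 b (odd b≡) , (λ eq → ≢2 b≡ (trans (sym (%-distribˡ-+ 1 b 8)) eq)) , ≢1,7 b≡
  where
  odd : b % 8 ≡ 3 ⊎ b % 8 ≡ 5 → b % 2 ≡ 1
  odd (inj₁ e) = trans (sym (%8-odd b)) (cong (_% 2) e)
  odd (inj₂ e) = trans (sym (%8-odd b)) (cong (_% 2) e)
  ≢2 : b % 8 ≡ 3 ⊎ b % 8 ≡ 5 → (1 + b % 8) % 8 ≢ 2
  ≢2 (inj₁ e) eq with () ← trans (cong (λ a → (1 + a) % 8) (sym e)) eq
  ≢2 (inj₂ e) eq with () ← trans (cong (λ a → (1 + a) % 8) (sym e)) eq
  ≢1,7 : b % 8 ≡ 3 ⊎ b % 8 ≡ 5 → ¬ (b % 8 ≡ 1 ⊎ b % 8 ≡ 7)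
  ≢1,7 (inj₁ e) (inj₁ f) with () ← trans (sym e) f
  ≢1,7 (inj₁ e) (inj₂ f) with () ← trans (sym e) f
  ≢1,7 (inj₂ e) (inj₁ f) with () ← trans (sym e) f
  ≢1,7 (inj₂ e) (inj₂ f) with () ← trans (sym e) f

prime≥2 : ∀ {p} → Prime p → 2 ≤ p
prime≥2 {p} p-prime = nonTrivial⇒n>1 p {{prime⇒nonTrivial p-prime}}

-- The exponents for fixed m and n

module _ (m n p q c : ℕ) (m≡ : m ≡ n + q) (p≡ : p ≡ m + n) (c≡ : c ≡ m * m + n * n)
         (p-prime : Prime p) (q-prime : Prime q) (0<n : 0 < n) (m⊥n : Coprime m n) (c%8 : c % 8 ≡ 5) where
  private
    b = p * q

    c+b≡2m² : c + b ≡ 2 * (m * m)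
    c+b≡2m² rewrite c≡ | p≡ | m≡ = expand n q
      where
      expand : ∀ n q → (n + q) * (n + q) + n * n + (n + q + n) * q ≡ 2 * ((n + q) * (n + q))
      expand = solve-∀

    b+2n²≡c : b + 2 * (n * n) ≡ c
    b+2n²≡c rewrite c≡ | p≡ | m≡ = expand n q
      where
      expand : ∀ n q → (n + q + n) * q + 2 * (n * n) ≡ (n + q) * (n + q) + n * n
      expand = solve-∀

    p²+q²≡2c : p * p + q * q ≡ 2 * c
    p²+q²≡2c rewrite c≡ | p≡ | m≡ = expand n q
      where
      expand : ∀ n q → (n + q + n) * (n + q + n) + q * q ≡ 2 * ((n + q) * (n + q) + n * n)
      expand = solve-∀

    p+q≡2m : p + q ≡ 2 * m
    p+q≡2m rewrite p≡ | m≡ = expand n q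
      where
      expand : ∀ n q → n + q + n + q ≡ 2 * (n + q)
      expand = solve-∀

    p≡q+2n : p ≡ q + 2 * n
    p≡q+2n rewrite p≡ | m≡ = expand n q
      where
      expand : ∀ n q → n + q + n ≡ q + 2 * n
      expand = solve-∀

    b%8 : b % 8 ≡ 3 ⊎ b % 8 ≡ 5
    b%8 = %8-from-sum b c m c%8 c+b≡2m²
    b-odd : b % 2 ≡ 1
    b-odd = proj₁ (%8-3-or-5 b b%8)
    b²%8 : (b * b) % 8 ≡ 1
    b²%8 = proj₁ (proj₂ (%8-3-or-5 b b%8))
    1+b%8 : (1 + b) % 8 ≢ 2
    1+b%8 = proj₁ (proj₂ (proj₂ (%8-3-or-5 b b%8)))
    b%8≢ : ¬ (b % 8 ≡ 1 ⊎ b % 8 ≡ 7)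
    b%8≢ = proj₂ (proj₂ (proj₂ (%8-3-or-5 b b%8)))

    2⊥b : Coprime 2 b
    2⊥b = coprime-2-odd b-odd

    -- A common divisor divides c + b = 2m² and c - b = 2n². It is odd because b is, so it divides
    -- the coprime numbers m² and n².
    c⊥b : Coprime c b
    c⊥b {d} (d∣c , d∣b) = coprime-* m⊥n² m⊥n² (d∣half m (subst (d ∣_) c+b≡2m² (∣m∣n⇒∣m+n d∣c d∣b))
                                               , d∣half n (∣m+n∣m⇒∣n (subst (d ∣_) (sym b+2n²≡c) d∣c) d∣b))
      where
      m⊥n² : Coprime m (n * n)
      m⊥n² = coprime-sym (coprime-* (coprime-sym m⊥n) (coprime-sym m⊥n))
      d∣half : ∀ a → d ∣ 2 * (a * a) → d ∣ a * a
      d∣half a = coprime-divisor λ (i∣d , i∣2) → 2⊥b (i∣2 , ∣-trans i∣d d∣b)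

    m⊥b : Coprime m b
    m⊥b {d} (d∣m , d∣b) = c⊥b (d∣c , d∣b)
      where
      d∣c : d ∣ c
      d∣c = ∣m+n∣m⇒∣n (subst (d ∣_) (trans (sym c+b≡2m²) (+-comm c b)) (∣n⇒∣m*n 2 (∣m⇒∣m*n m d∣m))) d∣b

    m⊥c : Coprime m c
    m⊥c {d} (d∣m , d∣c) = c⊥b (d∣c , ∣m+n∣m⇒∣n (subst (d ∣_) (sym c+b≡2m²) (∣n⇒∣m*n 2 (∣m⇒∣m*n m d∣m))) d∣c)

    p⊥c : Coprime p c
    p⊥c (d∣p , d∣c) = c⊥b (d∣c , ∣m⇒∣m*n q d∣p)

    q⊥c : Coprime q c
    q⊥c (d∣q , d∣c) = c⊥b (d∣c , ∣n⇒∣m*n p d∣q)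

    q<p : q < p
    q<p = subst (q <_) (sym p≡q+2n) (m<m+n q (≤-trans 0<n (m≤m+n n (n + 0))))

    p⊥q : Coprime p q
    p⊥q = prime∧∤⇒coprime p-prime λ p∣q → <⇒≱ q<p (∣⇒≤ {{prime⇒nonZero q-prime}} p∣q)

    2≤q : 2 ≤ q
    2≤q = prime≥2 q-prime

    c≢1 : c ≢ 1
    c≢1 eq with () ← trans (sym (cong (_% 8) eq)) c%8

    -- Modulo b one has c ≡ 2m², so the equation becomes x² ≡ 2 (m cʰ)² with m cʰ invertible.
    no-odd-exponent : ∀ x y h → x * x + b ^ suc y ≢ c ^ suc (h * 2)
    no-odd-exponent x y h eq = b%8≢ (2-residue b x (m * c ^ h) (b ^ y + c ^ h * c ^ h) b-odd
      (coprime-* m⊥b (coprime-^ h c⊥b)) (begin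
        2 * (m * C * (m * C))               ≡⟨ regroup m C ⟩
        2 * (m * m) * (C * C)               ≡⟨ cong (_* (C * C)) c+b≡2m² ⟨
        (c + b) * (C * C)                   ≡⟨ *-distribʳ-+ (C * C) c b ⟩
        c * (C * C) + b * (C * C)           ≡⟨ cong (λ a → c * a + b * (C * C)) (^-double c h) ⟨
        c ^ suc (h * 2) + b * (C * C)       ≡⟨ cong (_+ b * (C * C)) eq ⟨
        x * x + b * b ^ y + b * (C * C)     ≡⟨ collect (x * x) b (b ^ y) (C * C) ⟩
        x * x + (b ^ y + C * C) * b         ∎))
      where
      open ≡-Reasoning
      C = c ^ h
      regroup : ∀ m C → 2 * (m * C * (m * C)) ≡ 2 * (m * m) * (C * C)
      regroup = solve-∀
      collect : ∀ X b B C → X + b * B + b * C ≡ X + (B + C) * b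
      collect = solve-∀

    -- Modulo b the equation reads 1 ≡ 2 (cʰ)².
    no-even-exponent : ∀ y h → b ^ suc y + 1 ≢ 2 * c ^ (h * 2)
    no-even-exponent y h eq = b%8≢ (2-residue b 1 (c ^ h) (b ^ y) b-odd (coprime-^ h c⊥b) (begin
      2 * (c ^ h * c ^ h)       ≡⟨ cong (2 *_) (^-double c h) ⟨
      2 * c ^ (h * 2)           ≡⟨ eq ⟨
      b * b ^ y + 1             ≡⟨ +-comm (b * b ^ y) 1 ⟩
      1 + b * b ^ y             ≡⟨ cong (1 +_) (*-comm b (b ^ y)) ⟩
      1 * 1 + b ^ y * b         ∎))
      where open ≡-Reasoning

    -- Exhibits (c - 1) / 2, the number e of the Bézout identity in ℤ[i].
    c-odd : c ≡ 1 + 2 * (2 + 4 * (c / 8))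
    c-odd = trans (m≡m%n+[m/n]*n c 8) (trans (cong (_+ c / 8 * 8) c%8) (expand (c / 8)))
      where
      expand : ∀ x → 5 + x * 8 ≡ 1 + 2 * (2 + 4 * x)
      expand = solve-∀

    no-power+1 : ∀ y k → b ^ suc y + 1 ≢ 2 * c ^ k
    no-power+1 y k eq with parity k | parity (suc y)
    ... | h , inj₁ refl | _ = no-even-exponent y h eq
    -- Modulo 8 an odd power of b is b and 2 cᵏ is 2, so 1 + b would be 2, whereas b is 3 or 5.
    ... | h , inj₂ refl | l , inj₂ 1+y≡ = 1+b%8 (begin
        (1 + b) % 8                 ≡⟨ %-distribˡ-+ 1 b 8 ⟩
        (1 + b % 8) % 8             ≡⟨ cong (λ a → (1 + a) % 8) (%8-odd-power b l b²%8) ⟨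
        (1 + b ^ suc (l * 2) % 8) % 8 ≡⟨ %-distribˡ-+ 1 (b ^ suc (l * 2)) 8 ⟨
        (1 + b ^ suc (l * 2)) % 8   ≡⟨ cong (_% 8) (+-comm 1 (b ^ suc (l * 2))) ⟩
        (b ^ suc (l * 2) + 1) % 8   ≡⟨ cong (λ a → (b ^ a + 1) % 8) 1+y≡ ⟨
        (b ^ suc y + 1) % 8         ≡⟨ cong (_% 8) eq ⟩
        (2 * c ^ suc (h * 2)) % 8   ≡⟨ %8-double-power c (suc (h * 2)) c%8 ⟩
        2                           ∎)
      where open ≡-Reasoning
    -- The exponent of b is 2l, so X = bˡ satisfies X² + 1 = 2 cᵏ with k odd.
    ... | h , inj₂ refl | l , inj₁ 1+y≡ =
      let w , w²+1≡ , w∣ = X²+1≡2c^odd⇒w²+1≡2c c h (b ^ l) (2 + 4 * (c / 8)) c-odd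
            (trans (cong (_+ 1) (trans (sym (^-double b l)) (cong (b ^_) (sym 1+y≡)))) eq)
      in no-square+1 w l p-prime q-prime 2≤q 0<n p≡q+2n (trans w²+1≡ (sym p²+q²≡2c)) w∣

    power-sum⇒trivial : ∀ y k → p ^ suc y + q ^ suc y ≡ 2 * c ^ suc k → suc y ≡ 2 × suc k ≡ 1
    power-sum⇒trivial y k eq with parity (suc y)
    ... | h , inj₂ 1+y≡ = contradiction m≡1 (λ m≡1 → <⇒≱ 1<m (≤-reflexive m≡1))
      where
      2m∣2c^ : 2 * m ∣ 2 * c ^ suc k
      2m∣2c^ = subst₂ _∣_ p+q≡2m (trans (cong (λ a → p ^ a + q ^ a) (sym 1+y≡)) eq) (+∣^+^ p q h)
      m≡1 : m ≡ 1
      m≡1 = coprime-sym (coprime-^ (suc k) (coprime-sym m⊥c)) (∣-refl , *-cancelˡ-∣ 2 2m∣2c^)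
      1<m : 1 < m
      1<m = ≤-trans 2≤q (subst (q ≤_) (sym m≡) (m≤n+m q n))
    ... | l , inj₁ 1+y≡ = from-half (parity l)
      where
      square : ∀ a → a ^ suc y ≡ (a * a) ^ l
      square a = trans (cong (a ^_) 1+y≡) (^-square a l)
      eq′ : (p * p) ^ l + (q * q) ^ l ≡ 2 * c ^ suc k
      eq′ = trans (cong₂ _+_ (sym (square p)) (sym (square q))) eq
      p²⊥c : Coprime (p * p) c
      p²⊥c = coprime-* p⊥c p⊥c
      4≤ : ∀ a → 2 ≤ a → 2 ≤ a * a
      4≤ a 2≤a = ≤-trans (s≤s (s≤s z≤n)) (*-mono-≤ 2≤a 2≤a)

      from-half : (∃ λ j → l ≡ j * 2 ⊎ l ≡ suc (j * 2)) → suc y ≡ 2 × suc k ≡ 1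
      -- The power sums of p² and q² are used here: c divides p² + q² = 2c and is coprime to p² q²,
      -- so an even l would give c ∣ 2, impossible for the odd c ≠ 1.
      from-half (j , inj₁ refl) = contradiction
        (2⊥c (∣even-power-sum⇒∣2 (p * p) (q * q) j (divides 2 p²+q²≡2c)
               (coprime-sym (coprime-* p²⊥c (coprime-* q⊥c q⊥c)))
               (subst (c ∣_) (sym eq′) (∣n⇒∣m*n 2 (m∣m*n (c ^ k)))) , ∣-refl))
        c≢1
        where
        2⊥c : ∀ {d} → d ∣ 2 × d ∣ c → d ≡ 1
        2⊥c = coprime-2-odd (trans (sym (%8-odd c)) (cong (_% 2) c%8))
      from-half (zero , inj₂ refl) = 1+y≡ , cong suc ([ (λ k≡0 → k≡0) , (λ c≡1 → contradiction c≡1 c≢1) ]′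
        (m^n≡1⇒n≡0∨m≡1 c k (*-cancelˡ-≡ (c ^ k) 1 (2 * c) {{2c≢0}} (begin
          2 * c * c ^ k                  ≡⟨ *-assoc 2 c (c ^ k) ⟩
          2 * (c * c ^ k)                ≡⟨ eq′ ⟨
          p * p * 1 + q * q * 1          ≡⟨ cong₂ _+_ (*-identityʳ (p * p)) (*-identityʳ (q * q)) ⟩
          p * p + q * q                  ≡⟨ p²+q²≡2c ⟩
          2 * c                          ≡⟨ *-identityʳ (2 * c) ⟨
          2 * c * 1                      ∎))))
        where
        open ≡-Reasoning
        2c≢0 : NonZero (2 * c)
        2c≢0 = subst NonZero p²+q²≡2c (>-nonZero (≤-trans (≤-trans (s≤s z≤n) (4≤ q 2≤q)) (m≤n+m (q * q) (p * p))))
      from-half (suc j , inj₂ refl) = contradiction eq′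
        (no-odd-power-sum j (suc k) p²+q²≡2c p²⊥c (4≤ p (prime≥2 p-prime)) (4≤ q 2≤q))

  exponents : ∀ x y z → x * x + b ^ suc y ≡ c ^ suc z → suc y ≡ 2 × suc z ≡ 2
  exponents x y z eq with parity (suc z)
  ... | h , inj₂ 1+z≡ = contradiction (trans eq (cong (c ^_) 1+z≡)) (no-odd-exponent x y h)
  ... | suc k , inj₁ 1+z≡ = from-split (coprime-product-split (suc y) p-prime q-prime p⊥q A⊥B
                               (trans AB≡ (^-distribʳ-* p q (suc y))))
    where
    C = c ^ suc k
    A = C ∸ x
    eq′ : x * x + b ^ suc y ≡ C * C
    eq′ = trans eq (trans (cong (c ^_) 1+z≡) (^-double c (suc k)))
    instance
      b^≢0 : NonZero (b ^ suc y)
      b^≢0 = m^n≢0 b (suc y) {{m*n≢0 p q {{prime⇒nonZero p-prime}} {{prime⇒nonZero q-prime}}}}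
    -- The subtraction in `A` is not truncated: bʸ is positive, so x² < C².
    x+A≡C : x + A ≡ C
    x+A≡C = m+[n∸m]≡n {x} {C} (<⇒≤ (square-cancel-< (subst (x * x <_) eq′ (m<m+n (x * x) (>-nonZero⁻¹ (b ^ suc y))))))
    AB≡ : A * (C + x) ≡ b ^ suc y
    AB≡ = +-cancelˡ-≡ (x * x) _ _ (begin
      x * x + A * (C + x)         ≡⟨ cong (λ a → x * x + A * (a + x)) x+A≡C ⟨
      x * x + A * (x + A + x)     ≡⟨ expand x A ⟩
      (x + A) * (x + A)           ≡⟨ cong (λ a → a * a) x+A≡C ⟩
      C * C                       ≡⟨ eq′ ⟨
      x * x + b ^ suc y           ∎)
      where
      open ≡-Reasoning
      expand : ∀ x A → x * x + A * (x + A + x) ≡ (x + A) * (x + A)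
      expand = solve-∀
    A+B≡2C : A + (C + x) ≡ 2 * C
    A+B≡2C = begin
      A + (C + x)      ≡⟨ shuffle A C x ⟩
      C + (x + A)      ≡⟨ cong (C +_) x+A≡C ⟩
      C + C            ≡⟨ cong (C +_) (+-identityʳ C) ⟨
      2 * C            ∎
      where
      open ≡-Reasoning
      shuffle : ∀ A C x → A + (C + x) ≡ C + (x + A)
      shuffle = solve-∀
    -- A common divisor divides both the sum 2C and the product, a power of b, and 2C is coprime to
    -- b.
    A⊥B : Coprime A (C + x)
    A⊥B {d} (d∣A , d∣B) = coprime-^-^ 1 (suc y) 2C⊥b
      (subst (d ∣_) (trans A+B≡2C (sym (*-identityʳ (2 * C)))) (∣m∣n⇒∣m+n d∣A d∣B)
      , subst (d ∣_) AB≡ (∣m⇒∣m*n (C + x) d∣A))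
      where
      2C⊥b : Coprime (2 * C) b
      2C⊥b = coprime-* 2⊥b (coprime-^ (suc k) c⊥b)
    from-split : A + (C + x) ≡ p ^ suc y + q ^ suc y ⊎ A + (C + x) ≡ p ^ suc y * q ^ suc y + 1
               → suc y ≡ 2 × suc z ≡ 2
    from-split (inj₁ sum) =
      let 1+y≡2 , 1+k≡1 = power-sum⇒trivial y k (trans (sym sum) A+B≡2C)
      in 1+y≡2 , trans 1+z≡ (cong (_* 2) 1+k≡1)
    from-split (inj₂ sum) = contradiction
      (trans (cong (_+ 1) (^-distribʳ-* p q (suc y))) (trans (sym sum) A+B≡2C)) (no-power+1 y (suc k))

theorem1 : ∀ (m n : ℕ) → 0 < n → n < m → gcd m n ≡ 1 → m % 2 ≢ n % 2
    → (m ^ 2 + n ^ 2) % 8 ≡ 5 → Prime (m + n) → Prime (m ∸ n)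
    → ∀ (x y z : ℕ) → 0 < x → 0 < y → 0 < z
    → x ^ 2 + (m ^ 2 ∸ n ^ 2) ^ y ≡ (m ^ 2 + n ^ 2) ^ z
    → (x ≡ 2 * m * n) × (y ≡ 2) × (z ≡ 2)
theorem1 m n 0<n n<m gcd≡1 _ c%8 p-prime q-prime x (suc y) (suc z) _ _ _ eq =
  let 1+y≡2 , 1+z≡2 = exponents m n p q c m≡ refl c≡ p-prime q-prime 0<n (gcd≡1⇒coprime gcd≡1) c%8 x y z eq′
  in x≡ 1+y≡2 1+z≡2 , 1+y≡2 , 1+z≡2
  where
  open ≡-Reasoning
  p = m + n
  q = m ∸ n
  c = m ^ 2 + n ^ 2
  m≡ : m ≡ n + q
  m≡ = sym (m+[n∸m]≡n (<⇒≤ n<m))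
  ^2 : ∀ a → a ^ 2 ≡ a * a
  ^2 a = cong (a *_) (*-identityʳ a)
  c≡ : c ≡ m * m + n * n
  c≡ = cong₂ _+_ (^2 m) (^2 n)
  m²≡ : m ^ 2 ≡ p * q + n ^ 2
  m²≡ = begin
    m ^ 2                       ≡⟨ ^2 m ⟩
    m * m                       ≡⟨ cong (λ a → a * a) m≡ ⟩
    (n + q) * (n + q)           ≡⟨ expand n q ⟩
    (n + q + n) * q + n * n     ≡⟨ cong₂ (λ a b → (a + n) * q + b) m≡ (^2 n) ⟨
    p * q + n ^ 2               ∎
    where
    expand : ∀ n q → (n + q) * (n + q) ≡ (n + q + n) * q + n * n
    expand = solve-∀
  b≡ : m ^ 2 ∸ n ^ 2 ≡ p * q
  b≡ = trans (cong (_∸ n ^ 2) m²≡) (m+n∸n≡m (p * q) (n ^ 2))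
  eq′ : x * x + (p * q) ^ suc y ≡ c ^ suc z
  eq′ = trans (cong₂ (λ a b → a + b ^ suc y) (sym (^2 x)) (sym b≡)) eq
  x≡ : suc y ≡ 2 → suc z ≡ 2 → x ≡ 2 * m * n
  -- With both exponents 2, x is read off from (m² + n²)² = (2mn)² + (m² - n²)².
  x≡ refl refl = square-injective (+-cancelʳ-≡ ((p * q) ^ 2) _ _ (begin
    x * x + (p * q) ^ 2                                 ≡⟨ eq′ ⟩
    c ^ 2                                               ≡⟨ ^2 c ⟩
    c * c                                               ≡⟨ cong (λ a → a * a) c≡ ⟩
    (m * m + n * n) * (m * m + n * n)                   ≡⟨ cong (λ a → (a * a + n * n) * (a * a + n * n)) m≡ ⟩
    ((n + q) * (n + q) + n * n) * ((n + q) * (n + q) + n * n)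
                                                        ≡⟨ expand n q ⟩
    2 * (n + q) * n * (2 * (n + q) * n) + (n + q + n) * q * ((n + q + n) * q)
                                                        ≡⟨ cong (λ a → 2 * a * n * (2 * a * n) + (a + n) * q * ((a + n) * q)) m≡ ⟨
    2 * m * n * (2 * m * n) + p * q * (p * q)           ≡⟨ cong (2 * m * n * (2 * m * n) +_) (^2 (p * q)) ⟨
    2 * m * n * (2 * m * n) + (p * q) ^ 2               ∎))
    where
    expand : ∀ n q → ((n + q) * (n + q) + n * n) * ((n + q) * (n + q) + n * n)
           ≡ 2 * (n + q) * n * (2 * (n + q) * n) + (n + q + n) * q * ((n + q + n) * q)
    expand = solve-∀
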